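{- Let $G=(K,S,E(G))$ be a split graph on $n$ vertices. If $\delta(G)\ge \frac{3n}{5}$, then $\tau(G)\le 2\,\nu(G)$.
   Context: A split graph $G=(K,S,E(G))$ is a graph whose vertex set is partitioned into a clique $K$ and an independent set $S$. $\delta(G)$ is the minimum degree of $G$. A triangle hitting of $G$ is a set of edges whose removal leaves a triangle-free graph, and $\tau(G)$ is the minimum size of a triangle hitting; a triangle packing is a set of pairwise edge-disjoint triangles, and $\nu(G)$ is the maximum size of a triangle packing. -}

module Defs where

open import Data.Nat using (ℕ; _+_; _*_; _≤_)
open import Data.Bool using (Bool; true; false; T; if_then_else_)
open import Data.Fin using (Fin)
open import Data.List using (List; length; map; allFin)
open import Data.Nat.ListAction using (sum)
open import Data.List.Membership.Propositional using (_∈_)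
open import Data.List.Relation.Unary.AllPairs using (AllPairs)
open import Data.Product using (_×_; _,_; Σ; ∃; ∃-syntax)
open import Data.Sum using (_⊎_)
open import Relation.Nullary using (¬_)
open import Relation.Binary.PropositionalEquality using (_≡_; _≢_)

record Graph (n : ℕ) : Set where
  field
    adj   : Fin n → Fin n → Bool
    sym   : ∀ x y → adj x y ≡ adj y x
    irrefl : ∀ x → adj x x ≡ false

open Graph public

Adj : ∀ {n} → Graph n → Fin n → Fin n → Set
Adj G x y = T (adj G x y)

degree : ∀ {n} → Graph n → Fin n → ℕ
degree {n} G v = sum (map (λ y → if adj G v y then 1 else 0) (allFin n))

IsSplit : ∀ {n} → Graph n → (Fin n → Bool) → Set
IsSplit G inK =
  (∀ x y → T (inK x) → T (inK y) → x ≢ y → Adj G x y) ×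
  (∀ x y → inK x ≡ false → inK y ≡ false → ¬ Adj G x y)

Triple : ℕ → Set
Triple n = Fin n × Fin n × Fin n

IsTriangle : ∀ {n} → Graph n → Triple n → Set
IsTriangle G (a , b , c) =
  a ≢ b × b ≢ c × a ≢ c × Adj G a b × Adj G b c × Adj G a c

_∈T_ : ∀ {n} → Fin n → Triple n → Set
x ∈T (a , b , c) = x ≡ a ⊎ x ≡ b ⊎ x ≡ c

-- two triangles share an edge iff they share two distinct vertices
EdgeDisjoint : ∀ {n} → Triple n → Triple n → Set
EdgeDisjoint t u = ¬ (∃[ x ] ∃[ y ] (x ≢ y × x ∈T t × y ∈T t × x ∈T u × y ∈T u))

IsTrianglePacking : ∀ {n} → Graph n → List (Triple n) → Set
IsTrianglePacking G P =
  (∀ t → t ∈ P → IsTriangle G t) × AllPairs EdgeDisjoint P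

_∋E_,_ : ∀ {n} → List (Fin n × Fin n) → Fin n → Fin n → Set
H ∋E x , y = (x , y) ∈ H ⊎ (y , x) ∈ H

IsTriangleHitting : ∀ {n} → Graph n → List (Fin n × Fin n) → Set
IsTriangleHitting G H =
  (∀ x y → (x , y) ∈ H → Adj G x y) ×
  (∀ a b c → IsTriangle G (a , b , c) →
     H ∋E a , b ⊎ H ∋E b , c ⊎ H ∋E a , c)

-- τ(G) ≤ 2 ν(G)  ⇔  some triangle hitting H and some triangle packing P
-- satisfy |H| ≤ 2 |P|   (take H minimum, P maximum; conversely τ ≤ |H|, |P| ≤ ν)
TauLeTwoNu : ∀ {n} → Graph n → Set
TauLeTwoNu G =
  ∃[ H ] ∃[ P ] (IsTriangleHitting G H × IsTrianglePacking G P ×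
                 length H ≤ 2 * length P)

{-# OPTIONS --safe #-}
-- Packing: label the vertices by 0, …, n − 1.  Triangles whose labels have a given sum modulo n
-- are pairwise edge-disjoint, because two vertices determine the third, so some residue class
-- is a packing with at least a 1/n fraction of all triangles.  With k = |K| and d u the degree of
-- u ∈ S, G has C(k,3) + Σ C(d u,2) triangles.
-- Hitting: for A ⊆ K keep only the edges between A ∪ S and K ∖ A.  Choosing A of size
-- a = ⌊(k − |S|)/2⌋ with few neighbours in S deletes at most C(a,2) + C(k−a,2) + (a/k) Σ d u edges.
-- As 5 d u ≥ 3n forces 3|S| ≤ 2k, comparing the two bounds is a polynomial inequality
-- for k ≥ 30; the finitely many remaining values are checked by computation, where the integer
-- roundings matter.
module Submission where

open import Defs hiding (sym)
open import Data.Nat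
open import Data.Nat.Properties
open import Data.Nat.DivMod
  using (_/_; _%_; m/n≤m; m*n/n≡m; /-monoˡ-≤; m<n*o⇒m/o<n; m≡m%n+[m/n]*n;
         m%n<n; m<n⇒m%n≡m; %-distribˡ-+; [m+kn]%n≡m%n)
open import Data.Nat.Tactic.RingSolver using (solve-∀)
import Data.Nat.ListAction as List
import Data.Nat.ListAction.Properties as List
open import Data.Bool using (Bool; true; false; _∧_; _∨_; _xor_; not; T; if_then_else_)
open import Data.Bool.Properties using (T-≡; T-∧; T-∨; T?)
open import Data.Unit using (tt)
open import Data.Fin as Fin using (Fin; zero; suc)
import Data.Fin.Properties as Fin
open import Data.List
  using (List; []; _∷_; _++_; length; map; filter; allFin; tabulate; cartesianProduct)
open import Data.List.Properties using (map-tabulate; map-++; map-∘)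
open import Data.List.Membership.Propositional using (_∈_)
open import Data.List.Membership.Propositional.Properties
  using (∈-filter⁺; ∈-filter⁻; ∈-allFin; ∈-cartesianProduct⁺)
open import Data.List.Relation.Unary.All as All using (All; []; _∷_)
import Data.List.Relation.Unary.All.Properties as All
open import Data.List.Relation.Unary.AllPairs using (AllPairs; []; _∷_)
open import Data.List.Relation.Unary.Unique.Propositional using (Unique)
import Data.List.Relation.Unary.Unique.Propositional.Properties as Unique
open import Data.Product using (_×_; _,_; ∃-syntax; proj₁; proj₂)
open import Data.Sum using (inj₁; inj₂; _⊎_)
open import Relation.Nullary using (¬_; yes; no; does; contradiction)
open import Relation.Binary.Definitions using (tri<; tri≈; tri>)
open import Relation.Binary.PropositionalEquality
open import Function using (_∘_; id)
open import Function.Bundles using (Equivalence)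
open import Algebra.Properties.Semiring.Sum +-*-semiring
  using (sum; sum-cong-≗; ∑-distrib-+; ∑-comm; *-distribˡ-sum; *-distribʳ-sum)

open ≤-Reasoning

-- Comparison of the two bounds

-- The size of A comes from balancing. When every pair between A and S counts as an edge, twice the
-- number of deleted edges plus k is at most a² + (k - a)² + 2as, which is least at a = (k - s)/2;
-- the sides A ∪ S and K minus A then differ in size by at most one. With s = xk, the cubic terms of
-- the comparison leave a positive multiple of 25 - 117x + 141x² + 183x³. For x ≥ 0 its minimum is
-- about 7, near x = 0.27, so there is slack of order k³ against errors of order k², and only small
-- k escape. For these the real bounds are replaced by integral ones: degrees are at least ⌈3n/5⌉,
-- the sum of their squares is bounded by a secant through consecutive integers, the edges between A
-- and S by a rounded-down average, and the packing by a rounded-up quotient. Edges and triangles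
-- are counted as ordered pairs and triples, and negative terms stand on the opposite side of each
-- relation; this keeps binomial coefficients and truncated subtraction out of the algebra.

2xy≤x²+y² : ∀ x y → 2 * (x * y) ≤ x * x + y * y
2xy≤x²+y² x y with ≤-total x y
... | inj₁ x≤y = subst (λ y → 2 * (x * y) ≤ x * x + y * y) (m+[n∸m]≡n x≤y) (lem (y ∸ x))
  where
  lem : ∀ t → 2 * (x * (x + t)) ≤ x * x + (x + t) * (x + t)
  lem t = subst (2 * (x * (x + t)) ≤_) (eq x t) (m≤m+n _ (t * t))
    where
    eq : ∀ x t → 2 * (x * (x + t)) + t * t ≡ x * x + (x + t) * (x + t)
    eq = solve-∀
... | inj₂ y≤x = subst (λ x → 2 * (x * y) ≤ x * x + y * y) (m+[n∸m]≡n y≤x) (lem (x ∸ y))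
  where
  lem : ∀ t → 2 * ((y + t) * y) ≤ (y + t) * (y + t) + y * y
  lem t = subst (2 * ((y + t) * y) ≤_) (eq y t) (m≤m+n _ (t * t))
    where
    eq : ∀ y t → 2 * ((y + t) * y) + t * t ≡ (y + t) * (y + t) + y * y
    eq = solve-∀

-- The cubic part comes from s(4s − k)² ≥ 0 and k(8k − 26s)² ≥ 0 with room to spare,
-- which together with 30 ≤ k absorbs the terms of lower order.
cubic-bound : ∀ k s → 30 ≤ k → s ≤ k →
  117 * (k * k * s) + 150 * (k * k) + 30 * (k * s) + 180 * (s * s) + 75 * s
    ≤ 25 * (k * k * k) + 141 * (k * s * s) + 183 * (s * s * s) + 125 * k
cubic-bound k s 30≤k s≤k = *-cancelˡ-≤ 16 (+-cancelʳ-≤ (1464 * (k * s * s) + 208 * (k * k * s)) _ _ (begin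
  16 * lhs + (1464 * (k * s * s) + 208 * (k * k * s))
    ≡⟨ eq₁ k s ⟩
  183 * s * (2 * ((4 * s) * k)) + 5 * k * (2 * ((8 * k) * (26 * s)))
    + (80 * k * k * 30 + 16 * k * s * 30 + 96 * s * s * 30 + 1200 * s)
    ≤⟨ +-mono-≤ (+-mono-≤ (*-monoʳ-≤ (183 * s) (2xy≤x²+y² (4 * s) k))
                          (*-monoʳ-≤ (5 * k) (2xy≤x²+y² (8 * k) (26 * s))))
         (+-mono-≤ (+-mono-≤ (+-mono-≤ (*-monoʳ-≤ (80 * k * k) 30≤k) (*-monoʳ-≤ (16 * k * s) 30≤k))
                             (*-monoʳ-≤ (96 * s * s) 30≤k))
                   (*-monoʳ-≤ 1200 s≤k)) ⟩
  183 * s * ((4 * s) * (4 * s) + k * k) + 5 * k * ((8 * k) * (8 * k) + (26 * s) * (26 * s))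
    + (80 * k * k * k + 16 * k * s * k + 96 * s * s * k + 1200 * k)
    ≤⟨ m≤m+n _ _ ⟩
  183 * s * ((4 * s) * (4 * s) + k * k) + 5 * k * ((8 * k) * (8 * k) + (26 * s) * (26 * s))
    + (80 * k * k * k + 16 * k * s * k + 96 * s * s * k + 1200 * k)
    + (244 * (k * s * s) + 9 * (k * k * s) + 800 * k)
    ≡⟨ eq₂ k s ⟩
  16 * rhs + (1464 * (k * s * s) + 208 * (k * k * s)) ∎))
  where
  lhs = 117 * (k * k * s) + 150 * (k * k) + 30 * (k * s) + 180 * (s * s) + 75 * s
  rhs = 25 * (k * k * k) + 141 * (k * s * s) + 183 * (s * s * s) + 125 * k
  eq₁ : ∀ k s →
    16 * (117 * (k * k * s) + 150 * (k * k) + 30 * (k * s) + 180 * (s * s) + 75 * s)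
      + (1464 * (k * s * s) + 208 * (k * k * s))
    ≡ 183 * s * (2 * ((4 * s) * k)) + 5 * k * (2 * ((8 * k) * (26 * s)))
      + (80 * k * k * 30 + 16 * k * s * 30 + 96 * s * s * 30 + 1200 * s)
  eq₁ = solve-∀
  eq₂ : ∀ k s →
    183 * s * ((4 * s) * (4 * s) + k * k) + 5 * k * ((8 * k) * (8 * k) + (26 * s) * (26 * s))
      + (80 * k * k * k + 16 * k * s * k + 96 * s * s * k + 1200 * k)
      + (244 * (k * s * s) + 9 * (k * k * s) + 800 * k)
    ≡ 16 * (25 * (k * k * k) + 141 * (k * s * s) + 183 * (s * s * s) + 125 * k)
      + (1464 * (k * s * s) + 208 * (k * k * s))
  eq₂ = solve-∀

-- With `k` written as `2a + s + r`, `r ≤ 1`, twice `a² + (k - a)² + 2as` plus `s²` is exactly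
-- `k² + 2ks + r²`. The final `1` pays for the parity `r`.
balanced-hitting-size : ∀ {k s a e h} → s ≤ k → a ≡ (k ∸ s) / 2 → e ≤ a * s →
  2 * h + k ≤ a * a + (k ∸ a) * (k ∸ a) + 2 * e →
  4 * h + s * s + 2 * k ≤ k * k + 2 * (k * s) + 1
balanced-hitting-size {k} {s} {a} {e} {h} s≤k a≡ e≤as 2h≤ = subst
  (λ k → 2 * h + k ≤ a * a + (k ∸ a) * (k ∸ a) + 2 * e → 4 * h + s * s + 2 * k ≤ k * k + 2 * (k * s) + 1)
  (sym k≡) main 2h≤
  where
  r = (k ∸ s) % 2
  k≡ : k ≡ a + (a + s + r)
  k≡ = begin-equality
    k                   ≡⟨ m∸n+n≡m s≤k ⟨
    k ∸ s + s           ≡⟨ cong (_+ s) (m≡m%n+[m/n]*n (k ∸ s) 2) ⟩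
    r + (k ∸ s) / 2 * 2 + s ≡⟨ cong (λ a → r + a * 2 + s) (sym a≡) ⟩
    r + a * 2 + s       ≡⟨ eq r a s ⟩
    a + (a + s + r)     ∎
    where
    eq : ∀ r a s → r + a * 2 + s ≡ a + (a + s + r)
    eq = solve-∀
  r≤1 : r ≤ 1
  r≤1 = s≤s⁻¹ (m%n<n (k ∸ s) 2)
  main : 2 * h + (a + (a + s + r)) ≤ a * a + (a + (a + s + r) ∸ a) * (a + (a + s + r) ∸ a) + 2 * e →
    4 * h + s * s + 2 * (a + (a + s + r)) ≤
      (a + (a + s + r)) * (a + (a + s + r)) + 2 * ((a + (a + s + r)) * s) + 1
  main le rewrite m+n∸m≡n a (a + s + r) = begin
    4 * h + s * s + 2 * (a + (a + s + r))
      ≡⟨ eq₁ h s (a + (a + s + r)) ⟩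
    2 * (2 * h + (a + (a + s + r))) + s * s
      ≤⟨ +-monoˡ-≤ (s * s) (*-monoʳ-≤ 2 (≤-trans le (+-monoʳ-≤ (a * a + (a + s + r) * (a + s + r)) (*-monoʳ-≤ 2 e≤as)))) ⟩
    2 * (a * a + (a + s + r) * (a + s + r) + 2 * (a * s)) + s * s
      ≡⟨ eq₂ a s r ⟩
    (a + (a + s + r)) * (a + (a + s + r)) + 2 * ((a + (a + s + r)) * s) + r * r
      ≤⟨ +-monoʳ-≤ _ (*-mono-≤ r≤1 r≤1) ⟩
    (a + (a + s + r)) * (a + (a + s + r)) + 2 * ((a + (a + s + r)) * s) + 1 ∎
    where
    eq₁ : ∀ h s k → 4 * h + s * s + 2 * k ≡ 2 * (2 * h + k) + s * s
    eq₁ = solve-∀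
    eq₂ : ∀ a s r → 2 * (a * a + (a + s + r) * (a + s + r) + 2 * (a * s)) + s * s
      ≡ (a + (a + s + r)) * (a + (a + s + r)) + 2 * ((a + (a + s + r)) * s) + r * r
    eq₂ = solve-∀

-- A linear combination: `75 * (k + s)` times the hitting bound, 100 times the triangle count and 12
-- times the degree bound. With these weights `D` and `E` cancel, and `cubic-bound` compares the
-- polynomials in `k` and `s` that remain.
large-case : ∀ {k s E D N p h} → 30 ≤ k → s ≤ k →
  N ≤ 6 * ((k + s) * p) →
  k * k * k + 2 * k + 3 * D ≤ N + 3 * E + 3 * (k * k) →
  25 * E + 9 * ((k + s) * (k + s)) * s ≤ 25 * D + 15 * (k + s) * s →
  4 * h + s * s + 2 * k ≤ k * k + 2 * (k * s) + 1 →
  h ≤ 2 * p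
large-case {k} {s} {E} {D} {N} {p} {h} 30≤k s≤k N≤ ≤N E≤ h≤ =
  *-cancelˡ-≤ (300 * (k + s)) {{>-nonZero (*-mono-≤ {1} {300} (s≤s z≤n) (≤-trans (≤-trans (s≤s z≤n) 30≤k) (m≤m+n k s)))}}
    (+-cancelʳ-≤ (300 * (k * k) + 180 * (k + s) * s + 75 * (k + s) * (s * s + 2 * k)) _ _ (begin
  300 * (k + s) * h + (300 * (k * k) + 180 * (k + s) * s + 75 * (k + s) * (s * s + 2 * k))
    ≡⟨ eq₁ k s h ⟩
  75 * (k + s) * (4 * h + s * s + 2 * k) + (300 * (k * k) + 180 * (k + s) * s)
    ≤⟨ +-monoˡ-≤ _ (*-monoʳ-≤ (75 * (k + s)) h≤) ⟩
  75 * (k + s) * (k * k + 2 * (k * s) + 1) + (300 * (k * k) + 180 * (k + s) * s)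
    ≤⟨ ≤-by-cubic ⟩
  100 * (k * k * k) + 200 * k + 108 * ((k + s) * (k + s)) * s + 75 * (k + s) * (s * s + 2 * k)
    ≤⟨ +-monoˡ-≤ _ lower ⟩
  600 * (k + s) * p + (300 * (k * k) + 180 * (k + s) * s) + 75 * (k + s) * (s * s + 2 * k)
    ≡⟨ eq₂ k s p ⟩
  300 * (k + s) * (2 * p) + (300 * (k * k) + 180 * (k + s) * s + 75 * (k + s) * (s * s + 2 * k)) ∎))
  where
  eq₁ : ∀ k s h → 300 * (k + s) * h + (300 * (k * k) + 180 * (k + s) * s + 75 * (k + s) * (s * s + 2 * k))
    ≡ 75 * (k + s) * (4 * h + s * s + 2 * k) + (300 * (k * k) + 180 * (k + s) * s)
  eq₁ = solve-∀
  eq₂ : ∀ k s p → 600 * (k + s) * p + (300 * (k * k) + 180 * (k + s) * s) + 75 * (k + s) * (s * s + 2 * k)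
    ≡ 300 * (k + s) * (2 * p) + (300 * (k * k) + 180 * (k + s) * s + 75 * (k + s) * (s * s + 2 * k))
  eq₂ = solve-∀
  ≤-by-cubic : 75 * (k + s) * (k * k + 2 * (k * s) + 1) + (300 * (k * k) + 180 * (k + s) * s) ≤
    100 * (k * k * k) + 200 * k + 108 * ((k + s) * (k + s)) * s + 75 * (k + s) * (s * s + 2 * k)
  ≤-by-cubic = begin
    75 * (k + s) * (k * k + 2 * (k * s) + 1) + (300 * (k * k) + 180 * (k + s) * s)
      ≡⟨ eq₃ k s ⟩
    117 * (k * k * s) + 150 * (k * k) + 30 * (k * s) + 180 * (s * s) + 75 * s
      + (75 * (k * k * k) + 108 * (k * k * s) + 150 * (k * s * s) + 75 * k + 150 * (k * k) + 150 * (k * s))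
      ≤⟨ +-monoˡ-≤ _ (cubic-bound k s 30≤k s≤k) ⟩
    25 * (k * k * k) + 141 * (k * s * s) + 183 * (s * s * s) + 125 * k
      + (75 * (k * k * k) + 108 * (k * k * s) + 150 * (k * s * s) + 75 * k + 150 * (k * k) + 150 * (k * s))
      ≡⟨ eq₄ k s ⟩
    100 * (k * k * k) + 200 * k + 108 * ((k + s) * (k + s)) * s + 75 * (k + s) * (s * s + 2 * k) ∎
    where
    eq₃ : ∀ k s → 75 * (k + s) * (k * k + 2 * (k * s) + 1) + (300 * (k * k) + 180 * (k + s) * s)
      ≡ 117 * (k * k * s) + 150 * (k * k) + 30 * (k * s) + 180 * (s * s) + 75 * s
      + (75 * (k * k * k) + 108 * (k * k * s) + 150 * (k * s * s) + 75 * k + 150 * (k * k) + 150 * (k * s))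
    eq₃ = solve-∀
    eq₄ : ∀ k s → 25 * (k * k * k) + 141 * (k * s * s) + 183 * (s * s * s) + 125 * k
      + (75 * (k * k * k) + 108 * (k * k * s) + 150 * (k * s * s) + 75 * k + 150 * (k * k) + 150 * (k * s))
      ≡ 100 * (k * k * k) + 200 * k + 108 * ((k + s) * (k + s)) * s + 75 * (k + s) * (s * s + 2 * k)
    eq₄ = solve-∀
  lower : 100 * (k * k * k) + 200 * k + 108 * ((k + s) * (k + s)) * s ≤
    600 * (k + s) * p + (300 * (k * k) + 180 * (k + s) * s)
  lower = +-cancelʳ-≤ (300 * E + 300 * D) _ _ (begin
    100 * (k * k * k) + 200 * k + 108 * ((k + s) * (k + s)) * s + (300 * E + 300 * D)
      ≡⟨ eq₅ k s E D ⟩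
    100 * (k * k * k + 2 * k + 3 * D) + 12 * (25 * E + 9 * ((k + s) * (k + s)) * s)
      ≤⟨ +-mono-≤ (*-monoʳ-≤ 100 (≤-trans ≤N (+-monoˡ-≤ (3 * (k * k)) (+-monoˡ-≤ (3 * E) N≤)))) (*-monoʳ-≤ 12 E≤) ⟩
    100 * (6 * ((k + s) * p) + 3 * E + 3 * (k * k)) + 12 * (25 * D + 15 * (k + s) * s)
      ≡⟨ eq₆ k s E D p ⟩
    600 * (k + s) * p + (300 * (k * k) + 180 * (k + s) * s) + (300 * E + 300 * D) ∎)
    where
    eq₅ : ∀ k s E D → 100 * (k * k * k) + 200 * k + 108 * ((k + s) * (k + s)) * s + (300 * E + 300 * D)
      ≡ 100 * (k * k * k + 2 * k + 3 * D) + 12 * (25 * E + 9 * ((k + s) * (k + s)) * s)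
    eq₅ = solve-∀
    eq₆ : ∀ k s E D p → 100 * (6 * ((k + s) * p) + 3 * E + 3 * (k * k)) + 12 * (25 * D + 15 * (k + s) * s)
      ≡ 600 * (k + s) * p + (300 * (k * k) + 180 * (k + s) * s) + (300 * E + 300 * D)
    eq₆ = solve-∀

-- Finite check for cliques with fewer than 30 vertices

allBelow : ℕ → (ℕ → Bool) → Bool
allBelow zero    p = true
allBelow (suc m) p = p m ∧ allBelow m p

allBelow-sound : ∀ m p → allBelow m p ≡ true → ∀ {i} → i < m → p i ≡ true
allBelow-sound (suc m) p eq i<1+m with p m in pm
... | true with m<1+n⇒m<n∨m≡n i<1+m
...   | inj₁ i<m  = allBelow-sound m p eq i<m
...   | inj₂ refl = pm

ceil3/5 : ℕ → ℕ
ceil3/5 n = (3 * n + 4) / 5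

-- E is the number of edges between K and S, and F its excess over the minimum s q.
-- The left-hand side is an upper bound for 2 |H| and the last quotient a lower bound for |P|.
check : ℕ → ℕ → ℕ → Bool
check k s F = ((a * a + b * b + 2 * (a * E / suc (pred k))) ∸ k) ≤ᵇ 4 * ((X + m) / suc m)
  where
  n = k + s
  q = ceil3/5 n
  E = s * q + F
  a = (k ∸ s) / 2
  b = k ∸ a
  -- Raising a degree from `q` to `q + 1` adds `2 * q + 1` to its square, and each further unit adds
  -- more. So `s * (q * q) + 2 * q * F + F` bounds the sum of squared degrees `D` from below.
  X = (k * k * k + 2 * k + 3 * (s * (q * q) + 2 * q * F + F)) ∸ (3 * E + 3 * (k * k))
  m = pred (6 * n)

checkF : ℕ → ℕ → Bool
checkF k s = allBelow (suc (s * (k ∸ ceil3/5 (k + s)))) (check k s)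

checkK : ℕ → Bool
checkK k = allBelow (suc (2 * k / 3)) (checkF k)

-- All cases are decided by normalisation. The range of `k` stops where the hypothesis `30 ≤ k` of
-- `cubic-bound` begins; `s` stops at `2k/3`, and `F` where every degree would be `k`.
check-all : allBelow 30 checkK ≡ true
check-all = refl

m*o≤n⇒m≤n/o : ∀ m n o .{{_ : NonZero o}} → m * o ≤ n → m ≤ n / o
m*o≤n⇒m≤n/o m n o le = subst (_≤ n / o) (m*n/n≡m m o) (/-monoˡ-≤ o le)

check-sound : ∀ {k s F D N p e h} → 1 ≤ k → check k s F ≡ true →
  let n = k + s ; q = ceil3/5 n ; E = s * q + F ; a = (k ∸ s) / 2 in
  N ≤ 6 * (n * p) →
  k * k * k + 2 * k + 3 * D ≤ N + 3 * E + 3 * (k * k) →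
  (2 * q + 1) * E ≤ D + s * (q * q + q) →
  k * e ≤ a * E →
  2 * h + k ≤ a * a + (k ∸ a) * (k ∸ a) + 2 * e →
  h ≤ 2 * p
-- Matching on `suc k-1` lets the divisors `suc (pred k)` and `suc m` of `check` compute to `k` and
-- `6 * n`.
check-sound {k@(suc k-1)} {s} {F} {D} {N} {p} {e} {h} _ ok N≤ ≤N tangent ke≤aE h≤ = *-cancelˡ-≤ 2 (begin
  2 * h
    ≡⟨ m+n∸n≡m (2 * h) k ⟨
  2 * h + k ∸ k
    ≤⟨ ∸-monoˡ-≤ k (≤-trans h≤ (+-monoʳ-≤ (a * a + (k ∸ a) * (k ∸ a))
         (*-monoʳ-≤ 2 (m*o≤n⇒m≤n/o e (a * E) k (subst (_≤ a * E) (*-comm k e) ke≤aE))))) ⟩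
  (a * a + (k ∸ a) * (k ∸ a) + 2 * (a * E / k)) ∸ k
    ≤⟨ ≤ᵇ⇒≤ _ _ (subst T (sym ok) _) ⟩
  4 * ((X + m) / suc m)
    ≤⟨ *-monoʳ-≤ 4 (s≤s⁻¹ (m<n*o⇒m/o<n {n = suc p} (begin-strict
         X + m            <⟨ +-monoʳ-< X (n<1+n m) ⟩
         X + suc m        ≤⟨ +-monoˡ-≤ (suc m) (m≤n+o⇒m∸n≤o _ (3 * E + 3 * (k * k)) X≤) ⟩
         6 * (n * p) + suc m  ≡⟨ eq₀ n p ⟩
         suc p * suc m ∎))) ⟩
  4 * p
    ≡⟨ eq₁ p ⟩
  2 * (2 * p) ∎)
  where
  n = k + s
  q = ceil3/5 n
  E = s * q + F
  a = (k ∸ s) / 2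
  m = pred (6 * n)
  X = (k * k * k + 2 * k + 3 * (s * (q * q) + 2 * q * F + F)) ∸ (3 * E + 3 * (k * k))
  eq₀ : ∀ n p → 6 * (n * p) + 6 * n ≡ suc p * (6 * n)
  eq₀ = solve-∀
  eq₁ : ∀ p → 4 * p ≡ 2 * (2 * p)
  eq₁ = solve-∀
  D≥ : s * (q * q) + 2 * q * F + F ≤ D
  D≥ = +-cancelʳ-≤ (s * (q * q + q)) _ _ (subst (_≤ D + s * (q * q + q)) (eq s q F) tangent)
    where
    eq : ∀ s q F → (2 * q + 1) * (s * q + F) ≡ s * (q * q) + 2 * q * F + F + s * (q * q + q)
    eq = solve-∀
  X≤ : k * k * k + 2 * k + 3 * (s * (q * q) + 2 * q * F + F) ≤ 3 * E + 3 * (k * k) + 6 * (n * p)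
  X≤ = begin
    k * k * k + 2 * k + 3 * (s * (q * q) + 2 * q * F + F) ≤⟨ +-monoʳ-≤ (k * k * k + 2 * k) (*-monoʳ-≤ 3 D≥) ⟩
    k * k * k + 2 * k + 3 * D                             ≤⟨ ≤N ⟩
    N + 3 * E + 3 * (k * k)                               ≤⟨ +-monoˡ-≤ (3 * (k * k)) (+-monoˡ-≤ (3 * E) N≤) ⟩
    6 * (n * p) + 3 * E + 3 * (k * k)                     ≡⟨ eq (6 * (n * p)) (3 * E) (3 * (k * k)) ⟩
    3 * E + 3 * (k * k) + 6 * (n * p)                     ∎
    where
    eq : ∀ x y z → x + y + z ≡ y + z + x
    eq = solve-∀

small-case : ∀ {k s E D N p e h} → 1 ≤ k → k < 30 → 3 * s ≤ 2 * k →
  let n = k + s ; q = ceil3/5 n ; a = (k ∸ s) / 2 in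
  s * q ≤ E → E ≤ s * k →
  N ≤ 6 * (n * p) →
  k * k * k + 2 * k + 3 * D ≤ N + 3 * E + 3 * (k * k) →
  (2 * q + 1) * E ≤ D + s * (q * q + q) →
  k * e ≤ a * E →
  2 * h + k ≤ a * a + (k ∸ a) * (k ∸ a) + 2 * e →
  h ≤ 2 * p
small-case {k} {s} {E} 1≤k k<30 3s≤2k sq≤E E≤sk N≤ ≤N tangent ke≤aE h≤
  with E ∸ s * ceil3/5 (k + s) in F≡ | m+[n∸m]≡n sq≤E
... | F | refl = check-sound {k} {s} {F} 1≤k
    (allBelow-sound (suc (s * (k ∸ q))) (check k s)
      (allBelow-sound (suc (2 * k / 3)) (checkF k)
        (allBelow-sound 30 checkK check-all k<30)
        (s≤s (m*o≤n⇒m≤n/o s (2 * k) 3 (subst (_≤ 2 * k) (*-comm 3 s) 3s≤2k))))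
      (s≤s F≤))
    N≤ ≤N tangent ke≤aE h≤
  where
  q = ceil3/5 (k + s)
  F≤ : F ≤ s * (k ∸ q)
  F≤ = begin
    F                  ≡⟨ m+n∸m≡n (s * q) F ⟨
    s * q + F ∸ s * q  ≤⟨ ∸-monoˡ-≤ (s * q) E≤sk ⟩
    s * k ∸ s * q      ≡⟨ *-distribˡ-∸ s k q ⟨
    s * (k ∸ q)        ∎

tuza-inequality : ∀ {n k s E D N p e h} → k + s ≡ n → 1 ≤ k → 3 * s ≤ 2 * k →
  let q = ceil3/5 n ; a = (k ∸ s) / 2 in
  s * q ≤ E → E ≤ s * k →
  (2 * q + 1) * E ≤ D + s * (q * q + q) →
  25 * E + 9 * (n * n) * s ≤ 25 * D + 15 * n * s →
  k * k * k + 2 * k + 3 * D ≤ N + 3 * E + 3 * (k * k) →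
  N ≤ 6 * (n * p) →
  k * e ≤ a * E →
  2 * h + k ≤ a * a + (k ∸ a) * (k ∸ a) + 2 * e →
  h ≤ 2 * p
tuza-inequality {k = k} {s} {E} {D} {N} {p} {e} {h} refl 1≤k 3s≤2k sq≤E E≤sk tangent E≤ ≤N N≤ ke≤aE h≤ with k <? 30
... | yes k<30 = small-case {D = D} 1≤k k<30 3s≤2k sq≤E E≤sk N≤ ≤N tangent ke≤aE h≤
... | no  k≮30 = large-case {E = E} {D} (≮⇒≥ k≮30) s≤k N≤ ≤N E≤ (balanced-hitting-size {h = h} s≤k refl e≤as h≤)
  where
  s≤k : s ≤ k
  s≤k = *-cancelˡ-≤ 3 (≤-trans 3s≤2k (*-monoˡ-≤ k {2} {3} (s≤s (s≤s z≤n))))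
  a = (k ∸ s) / 2
  -- The cubic slack can afford to replace `E` by its maximum `s * k` here. The finite check instead
  -- keeps the average `a * E / k`.
  e≤as : e ≤ a * s
  e≤as = *-cancelˡ-≤ k {{>-nonZero 1≤k}} (begin
    k * e        ≤⟨ ke≤aE ⟩
    a * E        ≤⟨ *-monoʳ-≤ a E≤sk ⟩
    a * (s * k)  ≡⟨ eq a s k ⟩
    k * (a * s)  ∎)
    where
    eq : ∀ a s k → a * (s * k) ≡ k * (a * s)
    eq = solve-∀

-- Finite sums

⟦_⟧ : Bool → ℕ
⟦ b ⟧ = if b then 1 else 0

⟦∧⟧ : ∀ x y → ⟦ x ∧ y ⟧ ≡ ⟦ x ⟧ * ⟦ y ⟧
⟦∧⟧ true  y = sym (+-identityʳ ⟦ y ⟧)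
⟦∧⟧ false y = refl

δ : ∀ {n} → Fin n → Fin n → ℕ
δ i j = ⟦ does (i Fin.≟ j) ⟧

sum-mono : ∀ {n} {f g : Fin n → ℕ} → (∀ i → f i ≤ g i) → sum f ≤ sum g
sum-mono {zero}  f≤g = z≤n
sum-mono {suc n} f≤g = +-mono-≤ (f≤g zero) (sum-mono (f≤g ∘ suc))

sum≤n*m : ∀ {n} {f : Fin n → ℕ} {m} → (∀ i → f i ≤ m) → sum f ≤ n * m
sum≤n*m {zero}  f≤m = z≤n
sum≤n*m {suc n} f≤m = +-mono-≤ (f≤m zero) (sum≤n*m (f≤m ∘ suc))

sum-const : ∀ n m → sum {n} (λ _ → m) ≡ n * m
sum-const zero    m = refl
sum-const (suc n) m = cong (m +_) (sum-const n m)

term≤sum : ∀ {n} (f : Fin n → ℕ) i → f i ≤ sum f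
term≤sum f zero    = m≤m+n _ _
term≤sum f (suc i) = ≤-trans (term≤sum (f ∘ suc) i) (m≤n+m _ _)

sum-δ : ∀ {n} (i : Fin n) (f : Fin n → ℕ) → sum (λ j → δ i j * f j) ≡ f i
sum-δ {suc n} zero f = trans (cong (f zero + 0 +_) (trans (sum-const n 0) (*-zeroʳ n)))
                             (trans (+-identityʳ _) (+-identityʳ _))
sum-δ {suc n} (suc i) f = sum-δ i (f ∘ suc)

argmax : ∀ {n} (f : Fin (suc n) → ℕ) → ∃[ i ] ∀ j → f j ≤ f i
argmax {zero}  f = zero , λ { zero → ≤-refl }
argmax {suc n} f with argmax (f ∘ suc)
... | i , max with ≤-total (f zero) (f (suc i))
...   | inj₁ le = suc i , λ { zero → le ; (suc j) → max j }
...   | inj₂ ge = zero , λ { zero → ≤-refl ; (suc j) → ≤-trans (max j) ge }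

-- Meant for `w` the indicator of a vertex class: a relation that is affine in `f` at each vertex
-- can then be summed over the class, the constant term picking up the class size.
sum-affine : ∀ {n} (w f : Fin n → ℕ) x y →
  sum (λ i → w i * (x * f i + y)) ≡ x * sum (λ i → w i * f i) + y * sum w
sum-affine w f x y = begin-equality
  sum (λ i → w i * (x * f i + y))
    ≡⟨ sum-cong-≗ (λ i → eq (w i) (f i) x y) ⟩
  sum (λ i → x * (w i * f i) + y * w i)
    ≡⟨ ∑-distrib-+ (λ i → x * (w i * f i)) (λ i → y * w i) ⟩
  sum (λ i → x * (w i * f i)) + sum (λ i → y * w i)
    ≡⟨ cong₂ _+_ (*-distribˡ-sum x (λ i → w i * f i)) (*-distribˡ-sum y w) ⟨
  x * sum (λ i → w i * f i) + y * sum w ∎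
  where
  eq : ∀ w f x y → w * (x * f + y) ≡ x * (w * f) + y * w
  eq = solve-∀

sum² : ∀ {n} → (Fin n → Fin n → ℕ) → ℕ
sum² f = sum λ a → sum λ b → f a b

sum³ : ∀ {n} → (Fin n → Fin n → Fin n → ℕ) → ℕ
sum³ f = sum λ a → sum λ b → sum λ c → f a b c

module _ {n : ℕ} where

  sum²-cong : {f g : Fin n → Fin n → ℕ} → (∀ a b → f a b ≡ g a b) → sum² f ≡ sum² g
  sum²-cong eq = sum-cong-≗ λ a → sum-cong-≗ (eq a)

  sum²-mono : {f g : Fin n → Fin n → ℕ} → (∀ a b → f a b ≤ g a b) → sum² f ≤ sum² g
  sum²-mono le = sum-mono λ a → sum-mono (le a)

  sum²-distrib-+ : (f g : Fin n → Fin n → ℕ) → sum² (λ a b → f a b + g a b) ≡ sum² f + sum² g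
  sum²-distrib-+ f g = trans (sum-cong-≗ λ a → ∑-distrib-+ (f a) (g a)) (∑-distrib-+ (sum ∘ f) (sum ∘ g))

  sum³-mono : {f g : Fin n → Fin n → Fin n → ℕ} → (∀ a b c → f a b c ≤ g a b c) → sum³ f ≤ sum³ g
  sum³-mono le = sum-mono λ a → sum²-mono (le a)

  sum³-distrib-+ : (f g : Fin n → Fin n → Fin n → ℕ) →
    sum³ (λ a b c → f a b c + g a b c) ≡ sum³ f + sum³ g
  sum³-distrib-+ f g = trans (sum-cong-≗ λ a → sum²-distrib-+ (f a) (g a))
                             (∑-distrib-+ (λ a → sum² (f a)) (λ a → sum² (g a)))

  sum³-swap₁₂ : (f : Fin n → Fin n → Fin n → ℕ) → sum³ (λ a b c → f b a c) ≡ sum³ f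
  sum³-swap₁₂ f = ∑-comm (λ a b → sum (f b a))

  sum³-swap₂₃ : (f : Fin n → Fin n → Fin n → ℕ) → sum³ (λ a b c → f a c b) ≡ sum³ f
  sum³-swap₂₃ f = sum-cong-≗ λ a → ∑-comm (λ b c → f a c b)

  sum³-weight : (w : Fin n → ℕ) (f : Fin n → Fin n → Fin n → ℕ) →
    sum³ (λ a b c → w c * f a b c) ≡ sum (λ c → w c * sum² (λ a b → f a b c))
  sum³-weight w f = begin-equality
    sum³ (λ a b c → w c * f a b c)
      ≡⟨ sum³-swap₂₃ (λ a b c → w c * f a b c) ⟨
    sum³ (λ a c b → w c * f a b c)
      ≡⟨ sum³-swap₁₂ (λ a c b → w c * f a b c) ⟨
    sum³ (λ c a b → w c * f a b c)
      ≡⟨ sum-cong-≗ (λ c → trans (sum-cong-≗ λ a → sym (*-distribˡ-sum (w c) (λ b → f a b c)))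
                                 (sym (*-distribˡ-sum (w c) (λ a → sum λ b → f a b c)))) ⟩
    sum (λ c → w c * sum² (λ a b → f a b c)) ∎

-- Counting triangles

module _ {n : ℕ} (G : Graph n) where

  A : Fin n → Fin n → ℕ
  A x y = ⟦ adj G x y ⟧

  A-irrefl : ∀ x → A x x ≡ 0
  A-irrefl x = cong ⟦_⟧ (irrefl G x)

  Adj⇒A≡1 : ∀ {x y} → Adj G x y → A x y ≡ 1
  Adj⇒A≡1 {x} {y} xy with true ← adj G x y = refl

  ¬Adj⇒A≡0 : ∀ {x y} → ¬ Adj G x y → A x y ≡ 0
  ¬Adj⇒A≡0 {x} {y} xy with adj G x y
  ... | true = contradiction tt xy
  ... | false = refl

  -- On a clique the adjacency matrix is the all-ones matrix minus the identity. The added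
  -- `sum (⟦_⟧ ∘ p)` is that missing diagonal, written with `δ`.
  clique-pairs : (p : Fin n → Bool) → (∀ x y → T (p x) → T (p y) → x ≢ y → Adj G x y) →
    sum² (λ a b → ⟦ p a ⟧ * ⟦ p b ⟧ * A a b) + sum (⟦_⟧ ∘ p) ≡ sum (⟦_⟧ ∘ p) * sum (⟦_⟧ ∘ p)
  clique-pairs p clique = begin-equality
    sum² (λ a b → ⟦ p a ⟧ * ⟦ p b ⟧ * A a b) + sum (⟦_⟧ ∘ p)
      ≡⟨ cong (sum² (λ a b → ⟦ p a ⟧ * ⟦ p b ⟧ * A a b) +_) (sum-cong-≗ λ a → sum-δ a (⟦_⟧ ∘ p)) ⟨
    sum² (λ a b → ⟦ p a ⟧ * ⟦ p b ⟧ * A a b) + sum² (λ a b → δ a b * ⟦ p b ⟧)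
      ≡⟨ sum²-distrib-+ (λ a b → ⟦ p a ⟧ * ⟦ p b ⟧ * A a b) (λ a b → δ a b * ⟦ p b ⟧) ⟨
    sum² (λ a b → ⟦ p a ⟧ * ⟦ p b ⟧ * A a b + δ a b * ⟦ p b ⟧)
      ≡⟨ sum²-cong pointwise ⟩
    sum² (λ a b → ⟦ p a ⟧ * ⟦ p b ⟧)
      ≡⟨ sum-cong-≗ (λ a → *-distribˡ-sum ⟦ p a ⟧ (⟦_⟧ ∘ p)) ⟨
    sum (λ a → ⟦ p a ⟧ * sum (⟦_⟧ ∘ p))
      ≡⟨ *-distribʳ-sum (sum (⟦_⟧ ∘ p)) (⟦_⟧ ∘ p) ⟨
    sum (⟦_⟧ ∘ p) * sum (⟦_⟧ ∘ p) ∎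
    where
    pointwise : ∀ a b → ⟦ p a ⟧ * ⟦ p b ⟧ * A a b + δ a b * ⟦ p b ⟧ ≡ ⟦ p a ⟧ * ⟦ p b ⟧
    pointwise a b with a Fin.≟ b
    ... | yes refl rewrite A-irrefl a with p a
    ...   | true  = refl
    ...   | false = refl
    pointwise a b | no a≢b with p a in pa | p b in pb
    ... | false | _     = refl
    ... | true  | false = refl
    ... | true  | true rewrite Adj⇒A≡1 (clique a b (Equivalence.from T-≡ pa) (Equivalence.from T-≡ pb) a≢b) = refl

  -- Ordered triples, so each triangle is counted six times; irreflexivity already excludes repeated
  -- vertices.
  triangles : ℕ
  triangles = sum³ λ a b c → A a b * A b c * A a c

  module Split (inK : Fin n → Bool) (split : IsSplit G inK) where

    -- `d` counts neighbours in the clique only: the full degree for a vertex of S, and `k - 1` for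
    -- a vertex of K.
    κ σ d : Fin n → ℕ
    κ v = ⟦ inK v ⟧
    σ v = ⟦ not (inK v) ⟧
    d v = sum λ x → κ x * A x v

    k s E D : ℕ
    k = sum κ
    s = sum σ
    E = sum λ v → σ v * d v
    D = sum λ v → σ v * (d v * d v)

    κ+σ : ∀ v → κ v + σ v ≡ 1
    κ+σ v with inK v
    ... | true  = refl
    ... | false = refl

    k+s≡n : k + s ≡ n
    k+s≡n = begin-equality
      k + s                  ≡⟨ ∑-distrib-+ κ σ ⟨
      sum (λ v → κ v + σ v)  ≡⟨ sum-cong-≗ κ+σ ⟩
      sum {n} (λ _ → 1)      ≡⟨ sum-const n 1 ⟩
      n * 1                  ≡⟨ *-identityʳ n ⟩
      n                      ∎

    pairs : Fin n → ℕ
    pairs c = sum² λ a b → κ a * A a c * (κ b * A b c) * A a b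

    -- The neighbours of `c` inside K form a clique themselves, whichever part contains `c`, so
    -- `clique-pairs` applies to them.
    pairs+d : ∀ c → pairs c + d c ≡ d c * d c
    pairs+d c = begin-equality
      pairs c + d c
        ≡⟨ cong₂ _+_ (sum²-cong λ a b → cong₂ (λ x y → x * y * A a b) (sym (nbr≡ a)) (sym (nbr≡ b))) (sum-cong-≗ (sym ∘ nbr≡)) ⟩
      sum² (λ a b → ⟦ nbr a ⟧ * ⟦ nbr b ⟧ * A a b) + sum (⟦_⟧ ∘ nbr)
        ≡⟨ clique-pairs nbr (λ x y px py → proj₁ split x y (proj₁ (Equivalence.to T-∧ px)) (proj₁ (Equivalence.to T-∧ py))) ⟩
      sum (⟦_⟧ ∘ nbr) * sum (⟦_⟧ ∘ nbr)
        ≡⟨ cong (λ x → x * x) (sum-cong-≗ nbr≡) ⟩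
      d c * d c ∎
      where
      nbr : Fin n → Bool
      nbr x = inK x ∧ adj G x c
      nbr≡ : ∀ x → ⟦ nbr x ⟧ ≡ κ x * A x c
      nbr≡ x = ⟦∧⟧ (inK x) (adj G x c)

    suc-d≡k : ∀ c → T (inK c) → suc (d c) ≡ k
    suc-d≡k c c∈K = begin-equality
      1 + d c                                ≡⟨ +-comm 1 (d c) ⟩
      d c + 1                                ≡⟨ cong (d c +_) (sum-δ c (λ _ → 1)) ⟨
      d c + sum (λ x → δ c x * 1)            ≡⟨ ∑-distrib-+ (λ x → κ x * A x c) (λ x → δ c x * 1) ⟨
      sum (λ x → κ x * A x c + δ c x * 1)    ≡⟨ sum-cong-≗ pointwise ⟩
      k                                      ∎
      where
      pointwise : ∀ x → κ x * A x c + δ c x * 1 ≡ κ x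
      pointwise x with c Fin.≟ x
      ... | yes refl rewrite A-irrefl c | Equivalence.to T-≡ c∈K = refl
      ... | no c≢x with inK x in x∈K
      ...   | false = refl
      ...   | true rewrite Adj⇒A≡1 (proj₁ split x c (Equivalence.from T-≡ x∈K) c∈K (c≢x ∘ sym)) = refl

    d≤k : ∀ c → d c ≤ k
    d≤k c = sum-mono λ x → ≤-trans (*-monoʳ-≤ (κ x) (⟦⟧≤1 (adj G x c))) (≤-reflexive (*-identityʳ (κ x)))
      where
      ⟦⟧≤1 : ∀ b → ⟦ b ⟧ ≤ 1
      ⟦⟧≤1 true  = ≤-refl
      ⟦⟧≤1 false = z≤n

    -- This is the count `k(k - 1)(k - 2)` without subtraction. Each vertex of K contributes
    -- `(k - 1)(k - 2)`, by `pairs+d` with `d c = k - 1`.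
    clique-triangles : sum (λ c → κ c * pairs c) + 3 * (k * k) ≡ k * k * k + 2 * k
    clique-triangles = begin-equality
      sum (λ c → κ c * pairs c) + 3 * (k * k)
        ≡⟨ cong₂ _+_ (*-identityˡ (sum λ c → κ c * pairs c)) (*-assoc 3 k k) ⟨
      1 * sum (λ c → κ c * pairs c) + 3 * k * k
        ≡⟨ sum-affine κ pairs 1 (3 * k) ⟨
      sum (λ c → κ c * (1 * pairs c + 3 * k))
        ≡⟨ sum-cong-≗ pointwise ⟩
      sum (λ c → κ c * (k * k + 2))
        ≡⟨ *-distribʳ-sum (k * k + 2) κ ⟨
      k * (k * k + 2)
        ≡⟨ eq k ⟩
      k * k * k + 2 * k ∎
      where
      eq : ∀ k → k * (k * k + 2) ≡ k * k * k + 2 * k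
      eq = solve-∀
      arith : ∀ p d k → p + d ≡ d * d → suc d ≡ k → 1 * p + 3 * k ≡ k * k + 2
      arith p d .(suc d) p+d refl = begin-equality
        1 * p + 3 * suc d          ≡⟨ eq₁ p d ⟩
        p + d + (2 * d + 3)        ≡⟨ cong (_+ (2 * d + 3)) p+d ⟩
        d * d + (2 * d + 3)        ≡⟨ eq₂ d ⟩
        suc d * suc d + 2          ∎
        where
        eq₁ : ∀ p d → 1 * p + 3 * suc d ≡ p + d + (2 * d + 3)
        eq₁ = solve-∀
        eq₂ : ∀ d → d * d + (2 * d + 3) ≡ suc d * suc d + 2
        eq₂ = solve-∀
      pointwise : ∀ c → κ c * (1 * pairs c + 3 * k) ≡ κ c * (k * k + 2)
      pointwise c with inK c in c∈K
      ... | false = refl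
      ... | true  = cong (_+ 0) (arith (pairs c) (d c) k (pairs+d c) (suc-d≡k c (Equivalence.from T-≡ c∈K)))

    mixed-triangles : sum (λ c → σ c * pairs c) + E ≡ D
    mixed-triangles = begin-equality
      sum (λ c → σ c * pairs c) + E
        ≡⟨ ∑-distrib-+ (λ c → σ c * pairs c) (λ c → σ c * d c) ⟨
      sum (λ c → σ c * pairs c + σ c * d c)
        ≡⟨ sum-cong-≗ (λ c → trans (sym (*-distribˡ-+ (σ c) (pairs c) (d c))) (cong (σ c *_) (pairs+d c))) ⟩
      D ∎

    -- A vertex of S may take any of the three positions in an ordered triangle, whence the factor 3
    -- on `D` and `E`.
    triangles-lower-bound : k * k * k + 2 * k + 3 * D ≤ triangles + 3 * E + 3 * (k * k)
    triangles-lower-bound = begin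
      k * k * k + 2 * k + 3 * D
        ≡⟨ cong₂ (λ x y → x + 3 * y) clique-triangles mixed-triangles ⟨
      KK + 3 * (k * k) + 3 * (KS + E)
        ≡⟨ eq KK KS E (k * k) ⟩
      KK + KS + KS + KS + 3 * E + 3 * (k * k)
        ≤⟨ +-monoˡ-≤ (3 * (k * k)) (+-monoˡ-≤ (3 * E) split≤) ⟩
      triangles + 3 * E + 3 * (k * k) ∎
      where
      KK = sum (λ c → κ c * pairs c)
      KS = sum (λ c → σ c * pairs c)
      eq : ∀ x y E z → x + 3 * z + 3 * (y + E) ≡ x + y + y + y + 3 * E + 3 * z
      eq = solve-∀
      g : Fin n → Fin n → Fin n → ℕ
      g a b c = κ a * A a c * (κ b * A b c) * A a b
      f₁ f₂ f₃ f₄ : Fin n → Fin n → Fin n → ℕ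
      f₁ a b c = κ c * g a b c
      f₂ a b c = σ c * g a b c
      f₃ a b c = f₂ a c b
      f₄ a b c = f₂ c b a
      f₄-sum : sum³ f₄ ≡ sum³ f₂
      -- Reversing a triple is a product of three adjacent transpositions.
      f₄-sum = trans (sym (sum³-swap₁₂ f₄)) (trans (sym (sum³-swap₂₃ (λ a b c → f₂ c a b))) (sum³-swap₁₂ f₂))
      -- The four products are indicators of exclusive patterns: no vertex in S, or exactly one, in
      -- third, second or first place.
      weight≤1 : ∀ a b c → κ c * κ a * κ b + σ c * κ a * κ b + σ b * κ a * κ c + σ a * κ c * κ b ≤ 1
      weight≤1 a b c with inK a | inK b | inK c
      ... | true  | true  | true  = ≤-refl
      ... | true  | true  | false = ≤-refl
      ... | true  | false | true  = ≤-refl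
      ... | true  | false | false = z≤n
      ... | false | true  | true  = ≤-refl
      ... | false | true  | false = z≤n
      ... | false | false | true  = z≤n
      ... | false | false | false = z≤n
      collect : ∀ x y z x′ y′ z′ u v w →
        z * (x * w * (y * v) * u) + z′ * (x * w * (y * v) * u)
          + y′ * (x * u * (z * v) * w) + x′ * (z * w * (y * u) * v)
        ≡ (z * x * y + z′ * x * y + y′ * x * z + x′ * z * y) * (u * v * w)
      collect = solve-∀
      pointwise : ∀ a b c → f₁ a b c + f₂ a b c + f₃ a b c + f₄ a b c ≤ A a b * A b c * A a c
      pointwise a b c rewrite Graph.sym G c b | Graph.sym G b a | Graph.sym G c a = begin
        _ ≡⟨ collect (κ a) (κ b) (κ c) (σ a) (σ b) (σ c) (A a b) (A b c) (A a c) ⟩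
        (κ c * κ a * κ b + σ c * κ a * κ b + σ b * κ a * κ c + σ a * κ c * κ b) * (A a b * A b c * A a c)
          ≤⟨ *-monoˡ-≤ (A a b * A b c * A a c) (weight≤1 a b c) ⟩
        1 * (A a b * A b c * A a c) ≡⟨ *-identityˡ (A a b * A b c * A a c) ⟩
        A a b * A b c * A a c ∎
      split≤ : KK + KS + KS + KS ≤ triangles
      split≤ = begin
        KK + KS + KS + KS
          ≡⟨ cong₂ (λ x y → x + y + y + y) (sum³-weight κ g) (sum³-weight σ g) ⟨
        sum³ f₁ + sum³ f₂ + sum³ f₂ + sum³ f₂
          ≡⟨ cong₂ (λ x y → sum³ f₁ + sum³ f₂ + x + y) (sum³-swap₂₃ f₂) f₄-sum ⟨
        sum³ f₁ + sum³ f₂ + sum³ f₃ + sum³ f₄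
          ≡⟨ trans (sum³-distrib-+ (λ a b c → f₁ a b c + f₂ a b c + f₃ a b c) f₄) (cong (_+ sum³ f₄)
               (trans (sum³-distrib-+ (λ a b c → f₁ a b c + f₂ a b c) f₃) (cong (_+ sum³ f₃)
                 (sum³-distrib-+ f₁ f₂)))) ⟨
        sum³ (λ a b c → f₁ a b c + f₂ a b c + f₃ a b c + f₄ a b c)
          ≤⟨ sum³-mono pointwise ⟩
        triangles ∎

-- Hitting sets

sum-allFin : ∀ {n} (f : Fin n → ℕ) → List.sum (map f (allFin n)) ≡ sum f
sum-allFin {n} f = trans (cong List.sum (map-tabulate id f)) (sum-tabulate f)
  where
  sum-tabulate : ∀ {n} (f : Fin n → ℕ) → List.sum (tabulate f) ≡ sum f
  sum-tabulate {zero}  f = refl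
  sum-tabulate {suc n} f = cong (f zero +_) (sum-tabulate (f ∘ suc))

sum-cartesianProduct : ∀ {X Y : Set} (f : X × Y → ℕ) xs (ys : List Y) →
  List.sum (map f (cartesianProduct xs ys)) ≡ List.sum (map (λ x → List.sum (map (λ y → f (x , y)) ys)) xs)
sum-cartesianProduct f []       ys = refl
sum-cartesianProduct f (x ∷ xs) ys = begin-equality
  List.sum (map f (map (x ,_) ys ++ cartesianProduct xs ys))
    ≡⟨ cong List.sum (map-++ f (map (x ,_) ys) (cartesianProduct xs ys)) ⟩
  List.sum (map f (map (x ,_) ys) ++ map f (cartesianProduct xs ys))
    ≡⟨ List.sum-++ (map f (map (x ,_) ys)) _ ⟩
  List.sum (map f (map (x ,_) ys)) + List.sum (map f (cartesianProduct xs ys))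
    ≡⟨ cong₂ _+_ (cong List.sum (sym (map-∘ ys))) (sum-cartesianProduct f xs ys) ⟩
  List.sum (map (λ x → List.sum (map (λ y → f (x , y)) ys)) (x ∷ xs)) ∎

select : {X : Set} → (X → Bool) → List X → List X
select p = filter (T? ∘ p)

length-select : ∀ {X : Set} (p : X → Bool) xs → length (select p xs) ≡ List.sum (map (⟦_⟧ ∘ p) xs)
length-select p []       = refl
length-select p (x ∷ xs) with p x
... | true  = cong suc (length-select p xs)
... | false = length-select p xs

allPairs : ∀ n → List (Fin n × Fin n)
allPairs n = cartesianProduct (allFin n) (allFin n)

allTriples : ∀ n → List (Triple n)
allTriples n = cartesianProduct (allFin n) (allPairs n)

sum-allPairs : ∀ {n} (f : Fin n × Fin n → ℕ) →
  List.sum (map f (allPairs n)) ≡ sum² λ a b → f (a , b)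
sum-allPairs {n} f = trans (sum-cartesianProduct f (allFin n) (allFin n))
  (trans (sum-allFin (λ a → List.sum (map (λ b → f (a , b)) (allFin n)))) (sum-cong-≗ λ a → sum-allFin (λ b → f (a , b))))

length-select-pairs : ∀ {n} (p : Fin n × Fin n → Bool) →
  length (select p (allPairs n)) ≡ sum² λ a b → ⟦ p (a , b) ⟧
length-select-pairs {n} p = trans (length-select p (allPairs n)) (sum-allPairs (⟦_⟧ ∘ p))

length-select-triples : ∀ {n} (p : Triple n → Bool) →
  length (select p (allTriples n)) ≡ sum³ λ a b c → ⟦ p (a , b , c) ⟧
length-select-triples {n} p = trans (length-select p (allTriples n))
  (trans (sum-cartesianProduct (⟦_⟧ ∘ p) (allFin n) (allPairs n))
    (trans (sum-allFin (λ a → List.sum (map (λ bc → ⟦ p (a , bc) ⟧) (allPairs n)))) (sum-cong-≗ λ a → sum-allPairs (λ bc → ⟦ p (a , bc) ⟧))))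

lt : ∀ {n} → Fin n → Fin n → Bool
lt x y = Fin.toℕ x <ᵇ Fin.toℕ y

module _ {n : ℕ} (G : Graph n) where

  module _ (side : Fin n → Bool) where

    same : Fin n → Fin n → Bool
    same x y = not (side x xor side y)

    same-sym : ∀ x y → same x y ≡ same y x
    same-sym x y with side x | side y
    ... | true  | true  = refl
    ... | true  | false = refl
    ... | false | true  = refl
    ... | false | false = refl

    -- The condition `lt x y` lists each edge in one orientation only, so that the length of `uncut`
    -- is a number of edges.
    uncut? : Fin n × Fin n → Bool
    uncut? (x , y) = adj G x y ∧ lt x y ∧ same x y

    uncut : List (Fin n × Fin n)
    uncut = select uncut? (allPairs n)

    ∈-uncut : ∀ {x y} → Adj G x y → x Fin.< y → T (same x y) → (x , y) ∈ uncut
    ∈-uncut {x} {y} xy x<y s = ∈-filter⁺ (T? ∘ uncut?) (∈-cartesianProduct⁺ (∈-allFin x) (∈-allFin y))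
      (Equivalence.from T-∧ (xy , Equivalence.from T-∧ (<⇒<ᵇ x<y , s)))

    uncut-∋E : ∀ {x y} → x ≢ y → Adj G x y → T (same x y) → uncut ∋E x , y
    uncut-∋E {x} {y} x≢y xy s with Fin.<-cmp x y
    ... | tri< x<y _ _ = inj₁ (∈-uncut xy x<y s)
    ... | tri≈ _ x≡y _ = contradiction x≡y x≢y
    ... | tri> _ _ y<x = inj₂ (∈-uncut (subst T (Graph.sym G x y) xy) y<x (subst T (same-sym x y) s))

    same-among-three : ∀ a b c → T (same a b) ⊎ T (same b c) ⊎ T (same a c)
    same-among-three a b c with side a | side b | side c
    ... | true  | true  | _     = inj₁ tt
    ... | false | false | _     = inj₁ tt
    ... | true  | false | false = inj₂ (inj₁ tt)
    ... | false | true  | true  = inj₂ (inj₁ tt)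
    ... | true  | false | true  = inj₂ (inj₂ tt)
    ... | false | true  | false = inj₂ (inj₂ tt)

    -- The surviving edges join different sides and form a bipartite graph, while two of any three
    -- vertices share a side.
    uncut-hits : IsTriangleHitting G uncut
    uncut-hits = (λ x y xy∈ → proj₁ (Equivalence.to T-∧ (proj₂ (∈-filter⁻ (T? ∘ uncut?) {xs = allPairs n} xy∈)))) , hits
      where
      hits : ∀ a b c → IsTriangle G (a , b , c) → uncut ∋E a , b ⊎ uncut ∋E b , c ⊎ uncut ∋E a , c
      hits a b c (a≢b , b≢c , a≢c , ab , bc , ac) with same-among-three a b c
      ... | inj₁ s        = inj₁ (uncut-∋E a≢b ab s)
      ... | inj₂ (inj₁ s) = inj₂ (inj₁ (uncut-∋E b≢c bc s))
      ... | inj₂ (inj₂ s) = inj₂ (inj₂ (uncut-∋E a≢c ac s))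

    2*uncut≤ : 2 * length uncut ≤ sum² λ x y → A G x y * ⟦ same x y ⟧
    2*uncut≤ = begin
      2 * length uncut
        ≡⟨ cong (length uncut +_) (+-identityʳ (length uncut)) ⟩
      length uncut + length uncut
        ≡⟨ cong (λ l → l + l) (length-select-pairs uncut?) ⟩
      sum² (λ x y → ⟦ uncut? (x , y) ⟧) + sum² (λ x y → ⟦ uncut? (x , y) ⟧)
        ≡⟨ cong (sum² (λ x y → ⟦ uncut? (x , y) ⟧) +_) (∑-comm (λ x y → ⟦ uncut? (x , y) ⟧)) ⟩
      sum² (λ x y → ⟦ uncut? (x , y) ⟧) + sum² (λ x y → ⟦ uncut? (y , x) ⟧)
        ≡⟨ sum²-distrib-+ (λ x y → ⟦ uncut? (x , y) ⟧) (λ x y → ⟦ uncut? (y , x) ⟧) ⟨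
      sum² (λ x y → ⟦ uncut? (x , y) ⟧ + ⟦ uncut? (y , x) ⟧)
        ≤⟨ sum²-mono pointwise ⟩
      sum² (λ x y → A G x y * ⟦ same x y ⟧) ∎
      where
      pointwise : ∀ x y → ⟦ uncut? (x , y) ⟧ + ⟦ uncut? (y , x) ⟧ ≤ A G x y * ⟦ same x y ⟧
      pointwise x y rewrite Graph.sym G y x | same-sym y x with adj G x y
      ... | false = z≤n
      ... | true with same x y | lt x y in x<y | lt y x in y<x
      ...   | s     | false | false = z≤n
      ...   | true  | true  | false = ≤-refl
      ...   | false | true  | false = z≤n
      ...   | true  | false | true  = ≤-refl
      ...   | false | false | true  = z≤n
      ...   | _     | true  | true  = contradiction (<ᵇ⇒< _ _ (Equivalence.from T-≡ y<x))
                                        (Fin.<-asym (<ᵇ⇒< (Fin.toℕ x) _ (Equivalence.from T-≡ x<y)))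

heaviest : ∀ {n} (p : Fin n → Bool) (w : Fin n → ℕ) {a} → sum (⟦_⟧ ∘ p) ≡ suc a →
  ∃[ i ] (p i ≡ true × ∀ j → ⟦ p j ⟧ * w j ≤ ⟦ p j ⟧ * w i)
heaviest {suc n} p w {a} |p|≡ with argmax (λ i → ⟦ p i ⟧ * suc (w i))
-- With `suc (w i)` members of `p` score at least 1 and all others 0. A maximiser outside `p` would
-- therefore make `p` empty, even when all weights vanish.
... | i , max with p i in pi
...   | true = i , pi , le
  where
  le : ∀ j → ⟦ p j ⟧ * w j ≤ ⟦ p j ⟧ * w i
  le j with p j | max j
  ... | true  | m = +-monoˡ-≤ 0 (s≤s⁻¹ (subst₂ _≤_ (+-identityʳ _) (+-identityʳ _) m))
  ... | false | _ = z≤n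
...   | false = contradiction (trans (sym |p|≡) (n≤0⇒n≡0 (≤-trans (sum≤n*m zero-bound) (≤-reflexive (*-zeroʳ (suc n)))))) λ ()
  where
  zero-bound : ∀ j → ⟦ p j ⟧ ≤ 0
  zero-bound j with p j | max j
  ... | false | _ = z≤n

-- Removing the heaviest elements of q one at a time never increases the average weight.
light-subset : ∀ {n} (q : Fin n → Bool) (w : Fin n → ℕ) t a → a + t ≡ sum (⟦_⟧ ∘ q) →
  ∃[ p ] ((∀ v → T (p v) → T (q v)) × sum (⟦_⟧ ∘ p) ≡ a ×
    sum (⟦_⟧ ∘ q) * sum (λ v → ⟦ p v ⟧ * w v) ≤ a * sum (λ v → ⟦ q v ⟧ * w v))
light-subset q w zero    a a+t≡ = q , (λ _ → id) , sym a≡ , ≤-reflexive (cong (_* sum (λ v → ⟦ q v ⟧ * w v)) (sym a≡))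
  where
  a≡ : a ≡ sum (⟦_⟧ ∘ q)
  a≡ = trans (sym (+-identityʳ a)) a+t≡
light-subset {n} q w (suc t) a a+t≡ with light-subset q w t (suc a) (trans (sym (+-suc a t)) a+t≡)
... | p , p⊆q , |p|≡ , avg with heaviest p w |p|≡
...   | i , pi , heavy = p′ , (λ v → p⊆q v ∘ proj₁ ∘ Equivalence.to T-∧) , |p′|≡ , *-cancelˡ-≤ (suc a) (begin
  suc a * (k * W′)           ≡⟨ eq₁ (suc a) k W′ ⟩
  k * (suc a * W′)           ≤⟨ *-monoʳ-≤ k (+-monoˡ-≤ (a * W′) W′≤) ⟩
  k * (a * w i + a * W′)     ≡⟨ cong (k *_) (*-distribˡ-+ a (w i) W′) ⟨
  k * (a * (w i + W′))       ≡⟨ cong (λ x → k * (a * x)) (remove w) ⟨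
  k * (a * W)                ≡⟨ eq₁ k a W ⟩
  a * (k * W)                ≤⟨ *-monoʳ-≤ a avg ⟩
  a * (suc a * Wq)           ≡⟨ eq₁ a (suc a) Wq ⟩
  suc a * (a * Wq) ∎)
  where
  p′ : Fin n → Bool
  p′ v = p v ∧ not (does (i Fin.≟ v))
  k = sum (⟦_⟧ ∘ q)
  W = sum λ v → ⟦ p v ⟧ * w v
  W′ = sum λ v → ⟦ p′ v ⟧ * w v
  Wq = sum λ v → ⟦ q v ⟧ * w v
  eq₁ : ∀ x y z → x * (y * z) ≡ y * (x * z)
  eq₁ = solve-∀
  remove : ∀ (f : Fin n → ℕ) → sum (λ v → ⟦ p v ⟧ * f v) ≡ f i + sum (λ v → ⟦ p′ v ⟧ * f v)
  remove f = begin-equality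
    sum (λ v → ⟦ p v ⟧ * f v)
      ≡⟨ sum-cong-≗ pointwise ⟩
    sum (λ v → δ i v * f v + ⟦ p′ v ⟧ * f v)
      ≡⟨ ∑-distrib-+ (λ v → δ i v * f v) (λ v → ⟦ p′ v ⟧ * f v) ⟩
    sum (λ v → δ i v * f v) + sum (λ v → ⟦ p′ v ⟧ * f v)
      ≡⟨ cong (_+ sum (λ v → ⟦ p′ v ⟧ * f v)) (sum-δ i f) ⟩
    f i + sum (λ v → ⟦ p′ v ⟧ * f v) ∎
    where
    pointwise : ∀ v → ⟦ p v ⟧ * f v ≡ δ i v * f v + ⟦ p′ v ⟧ * f v
    pointwise v with i Fin.≟ v
    ... | yes refl rewrite pi = sym (+-identityʳ _)
    ... | no _ with p v
    ...   | true  = refl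
    ...   | false = refl
  |p′|≡ : sum (⟦_⟧ ∘ p′) ≡ a
  |p′|≡ = suc-injective (begin-equality
    1 + sum (⟦_⟧ ∘ p′)            ≡⟨ cong suc (sum-cong-≗ λ v → sym (*-identityʳ ⟦ p′ v ⟧)) ⟩
    1 + sum (λ v → ⟦ p′ v ⟧ * 1)  ≡⟨ remove (λ _ → 1) ⟨
    sum (λ v → ⟦ p v ⟧ * 1)       ≡⟨ sum-cong-≗ (λ v → *-identityʳ ⟦ p v ⟧) ⟩
    sum (⟦_⟧ ∘ p)                 ≡⟨ |p|≡ ⟩
    suc a                         ∎)
  W′≤ : W′ ≤ a * w i
  W′≤ = begin
    W′                               ≤⟨ sum-mono pointwise ⟩
    sum (λ v → ⟦ p′ v ⟧ * w i)       ≡⟨ *-distribʳ-sum (w i) (⟦_⟧ ∘ p′) ⟨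
    sum (⟦_⟧ ∘ p′) * w i             ≡⟨ cong (_* w i) |p′|≡ ⟩
    a * w i ∎
    where
    pointwise : ∀ v → ⟦ p′ v ⟧ * w v ≤ ⟦ p′ v ⟧ * w i
    pointwise v with p v | heavy v | i Fin.≟ v
    ... | true  | h | no _  = h
    ... | true  | _ | yes _ = z≤n
    ... | false | _ | _     = z≤n

-- Packings

-- `m * (n ∸ 1)` acts as the negative of `m` modulo `n`; adding it recovers the summand, which is
-- its own residue.
%-cancelˡ : ∀ {n} .{{_ : NonZero n}} m {x y} → x < n → y < n → (m + x) % n ≡ (m + y) % n → x ≡ y
%-cancelˡ {n} m {x} {y} x<n y<n eq = trans (sym (recover x x<n)) (trans (cong (λ r → (r + (m * (n ∸ 1)) % n) % n) eq) (recover y y<n))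
  where
  recover : ∀ z → z < n → ((m + z) % n + (m * (n ∸ 1)) % n) % n ≡ z
  recover z z<n = begin-equality
    ((m + z) % n + (m * (n ∸ 1)) % n) % n   ≡⟨ %-distribˡ-+ (m + z) (m * (n ∸ 1)) n ⟨
    (m + z + m * (n ∸ 1)) % n               ≡⟨ cong (_% n) (shuffle m z (n ∸ 1)) ⟩
    (z + m * (1 + (n ∸ 1))) % n             ≡⟨ cong (λ k → (z + m * k) % n) (m+[n∸m]≡n (>-nonZero⁻¹ n)) ⟩
    (z + m * n) % n                         ≡⟨ [m+kn]%n≡m%n z m n ⟩
    z % n                                   ≡⟨ m<n⇒m%n≡m z<n ⟩
    z                                       ∎
    where
    shuffle : ∀ m z k → m + z + m * k ≡ z + m * (1 + k)
    shuffle = solve-∀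

total : ∀ {n} → Triple n → ℕ
total (a , b , c) = Fin.toℕ a + Fin.toℕ b + Fin.toℕ c

Increasing : ∀ {n} → Triple n → Set
Increasing (a , b , c) = a Fin.< b × b Fin.< c

swap₁₂ : {P Q R : Set} → P ⊎ Q ⊎ R → Q ⊎ P ⊎ R
swap₁₂ (inj₁ p)        = inj₂ (inj₁ p)
swap₁₂ (inj₂ (inj₁ q)) = inj₁ q
swap₁₂ (inj₂ (inj₂ r)) = inj₂ (inj₂ r)

swap₂₃ : {P Q R : Set} → P ⊎ Q ⊎ R → P ⊎ R ⊎ Q
swap₂₃ (inj₁ p)        = inj₁ p
swap₂₃ (inj₂ (inj₁ q)) = inj₂ (inj₂ q)
swap₂₃ (inj₂ (inj₂ r)) = inj₂ (inj₁ r)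

-- Moves two chosen vertices to the front. Label sum and vertex set are symmetric, so each of the
-- six positions is a permutation of the triple.
third-vertex : ∀ {n} {t : Triple n} {x y} → x ≢ y → x ∈T t → y ∈T t →
  ∃[ z ] (total t ≡ Fin.toℕ x + Fin.toℕ y + Fin.toℕ z × (∀ {v} → v ∈T t → v ∈T (x , y , z)) × (∀ {v} → v ∈T (x , y , z) → v ∈T t))
third-vertex x≢y (inj₁ refl)        (inj₁ refl)        = contradiction refl x≢y
third-vertex x≢y (inj₂ (inj₁ refl)) (inj₂ (inj₁ refl)) = contradiction refl x≢y
third-vertex x≢y (inj₂ (inj₂ refl)) (inj₂ (inj₂ refl)) = contradiction refl x≢y
third-vertex {t = a , b , c} _ (inj₁ refl)        (inj₂ (inj₁ refl)) = c , refl , id , id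
third-vertex {t = a , b , c} _ (inj₁ refl)        (inj₂ (inj₂ refl)) = b , eq (Fin.toℕ a) (Fin.toℕ b) (Fin.toℕ c) , swap₂₃ , swap₂₃
  where
  eq : ∀ a b c → a + b + c ≡ a + c + b
  eq = solve-∀
third-vertex {t = a , b , c} _ (inj₂ (inj₁ refl)) (inj₁ refl)        = c , eq (Fin.toℕ a) (Fin.toℕ b) (Fin.toℕ c) , swap₁₂ , swap₁₂
  where
  eq : ∀ a b c → a + b + c ≡ b + a + c
  eq = solve-∀
third-vertex {t = a , b , c} _ (inj₂ (inj₁ refl)) (inj₂ (inj₂ refl)) = a , eq (Fin.toℕ a) (Fin.toℕ b) (Fin.toℕ c) , swap₂₃ ∘ swap₁₂ , swap₁₂ ∘ swap₂₃
  where
  eq : ∀ a b c → a + b + c ≡ b + c + a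
  eq = solve-∀
third-vertex {t = a , b , c} _ (inj₂ (inj₂ refl)) (inj₁ refl)        = b , eq (Fin.toℕ a) (Fin.toℕ b) (Fin.toℕ c) , swap₁₂ ∘ swap₂₃ , swap₂₃ ∘ swap₁₂
  where
  eq : ∀ a b c → a + b + c ≡ c + a + b
  eq = solve-∀
third-vertex {t = a , b , c} _ (inj₂ (inj₂ refl)) (inj₂ (inj₁ refl)) =
  a , eq (Fin.toℕ a) (Fin.toℕ b) (Fin.toℕ c) , swap₁₂ ∘ swap₂₃ ∘ swap₁₂ , swap₁₂ ∘ swap₂₃ ∘ swap₁₂
  where
  eq : ∀ a b c → a + b + c ≡ c + b + a
  eq = solve-∀

increasing-unique : ∀ {n} {t u : Triple n} → Increasing t → Increasing u →
  (∀ {v} → v ∈T t → v ∈T u) → (∀ {v} → v ∈T u → v ∈T t) → t ≡ u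
increasing-unique {t = t@(a , b , c)} {u = u@(a′ , b′ , c′)} (a<b , b<c) (a′<b′ , b′<c′) t⊆u u⊆t = cong₂ _,_ a≡a′ (cong₂ _,_ b≡b′ c≡c′)
  where
  lowest : ∀ {n} {x a b c : Fin n} → Increasing (a , b , c) → x ∈T (a , b , c) → a Fin.≤ x
  lowest _           (inj₁ refl)        = ≤-refl
  lowest (a<b , _)   (inj₂ (inj₁ refl)) = <⇒≤ a<b
  lowest (a<b , b<c) (inj₂ (inj₂ refl)) = <⇒≤ (<-trans a<b b<c)
  highest : ∀ {n} {x a b c : Fin n} → Increasing (a , b , c) → x ∈T (a , b , c) → x Fin.≤ c
  highest (a<b , b<c) (inj₁ refl)        = <⇒≤ (<-trans a<b b<c)
  highest (_ , b<c)   (inj₂ (inj₁ refl)) = <⇒≤ b<c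
  highest _           (inj₂ (inj₂ refl)) = ≤-refl
  a≡a′ : a ≡ a′
  a≡a′ = Fin.≤-antisym (lowest (a<b , b<c) (u⊆t (inj₁ refl))) (lowest (a′<b′ , b′<c′) (t⊆u (inj₁ refl)))
  c≡c′ : c ≡ c′
  c≡c′ = Fin.≤-antisym (highest (a′<b′ , b′<c′) (t⊆u (inj₂ (inj₂ refl)))) (highest (a<b , b<c) (u⊆t (inj₂ (inj₂ refl))))
  b≡b′ : b ≡ b′
  b≡b′ with t⊆u (inj₂ (inj₁ refl))
  ... | inj₁ b≡a′        = contradiction (trans a≡a′ (sym b≡a′)) (Fin.<⇒≢ a<b)
  ... | inj₂ (inj₁ b≡b′) = b≡b′
  ... | inj₂ (inj₂ b≡c′) = contradiction (trans b≡c′ (sym c≡c′)) (Fin.<⇒≢ b<c)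

-- If `x` and `y` are shared, the third labels are congruent modulo `n` and below `n`, hence equal.
-- The triples then have the same vertices and, being increasing, coincide.
equal-residue⇒EdgeDisjoint : ∀ {n} .{{_ : NonZero n}} {t u : Triple n} → Increasing t → Increasing u →
  total t % n ≡ total u % n → t ≢ u → EdgeDisjoint t u
equal-residue⇒EdgeDisjoint {n} {t = t} {u} t↗ u↗ t≡u% t≢u (x , y , x≢y , x∈t , y∈t , x∈u , y∈u)
  with third-vertex {t = t} x≢y x∈t y∈t | third-vertex {t = u} x≢y x∈u y∈u
... | z , t≡ , t⊆ , ⊆t | z′ , u≡ , u⊆ , ⊆u
  with Fin.toℕ-injective (%-cancelˡ (Fin.toℕ x + Fin.toℕ y) (Fin.toℕ<n z) (Fin.toℕ<n z′)
         (trans (cong (_% n) (sym t≡)) (trans t≡u% (cong (_% n) u≡))))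
... | refl = t≢u (increasing-unique t↗ u↗ (λ v∈ → ⊆u (t⊆ v∈)) (λ v∈ → ⊆t (u⊆ v∈)))

-- Rédei's theorem for three vertices: a tournament has a Hamiltonian path, and the six summands are
-- the six possible paths. Totality of the comparison suffices.
some-order : ∀ {a<b b<a b<c c<b a<c c<a} → T (a<b ∨ b<a) → T (b<c ∨ c<b) → T (a<c ∨ c<a) →
  1 ≤ ⟦ a<b ∧ b<c ⟧ + ⟦ a<c ∧ c<b ⟧ + ⟦ b<a ∧ a<c ⟧ + ⟦ b<c ∧ c<a ⟧ + ⟦ c<a ∧ a<b ⟧ + ⟦ c<b ∧ b<a ⟧
some-order {true}  {_}     {true}  {_}     {_}     {_}    _ _ _ = s≤s z≤n
some-order {true}  {_}     {false} {true}  {true}  {_}    _ _ _ = s≤s z≤n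
some-order {true}  {true}  {false} {true}  {false} {true} _ _ _ = s≤s z≤n
some-order {true}  {false} {false} {true}  {false} {true} _ _ _ = s≤s z≤n
some-order {false} {true}  {true}  {true}  {true}  {_}    _ _ _ = s≤s z≤n
some-order {false} {true}  {true}  {false} {true}  {_}    _ _ _ = s≤s z≤n
some-order {false} {true}  {true}  {_}     {false} {true} _ _ _ = s≤s z≤n
some-order {false} {true}  {false} {true}  {true}  {_}    _ _ _ = s≤s z≤n
some-order {false} {true}  {false} {true}  {false} {true} _ _ _ = s≤s z≤n

All⇒AllPairs : ∀ {X : Set} {P : X → Set} {R : X → X → Set} → (∀ {x y} → P x → P y → x ≢ y → R x y) →
  ∀ {xs} → All P xs → Unique xs → AllPairs R xs
All⇒AllPairs f []         []         = []
All⇒AllPairs f (px ∷ pxs) (x∉ ∷ xs!) = All.zipWith (λ (py , x≢y) → f px py x≢y) (pxs , x∉) ∷ All⇒AllPairs f pxs xs!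

module _ {m : ℕ} (G : Graph (suc m)) where

  private n = suc m

  -- Fixing the increasing order makes distinct list entries distinct triangles; otherwise a class
  -- would contain all six orderings of one triangle.
  triangle? : Triple n → Bool
  triangle? (a , b , c) = (adj G a b ∧ adj G b c ∧ adj G a c) ∧ (lt a b ∧ lt b c)

  class? : Fin n → Triple n → Bool
  class? r t = triangle? t ∧ (total t % n ≡ᵇ Fin.toℕ r)

  class : Fin n → List (Triple n)
  class r = select (class? r) (allTriples n)

  class?⇒ : ∀ {r} t → T (class? r t) → IsTriangle G t × Increasing t × total t % n ≡ Fin.toℕ r
  class?⇒ (a , b , c) t∈ =
    let tri , res = Equivalence.to T-∧ t∈
        abc , ord = Equivalence.to T-∧ tri
        lt-ab , lt-bc = Equivalence.to T-∧ ord
        ab , bcac = Equivalence.to T-∧ abc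
        bc , ac   = Equivalence.to T-∧ bcac
        a<b = <ᵇ⇒< (Fin.toℕ a) (Fin.toℕ b) lt-ab
        b<c = <ᵇ⇒< (Fin.toℕ b) (Fin.toℕ c) lt-bc
    in (Fin.<⇒≢ a<b , Fin.<⇒≢ b<c , Fin.<⇒≢ (<-trans a<b b<c) , ab , bc , ac) , (a<b , b<c) , ≡ᵇ⇒≡ _ _ res

  class-packing : ∀ r → IsTrianglePacking G (class r)
  class-packing r =
    (λ t t∈ → proj₁ (class?⇒ t (proj₂ (∈-filter⁻ (T? ∘ class? r) {xs = allTriples n} t∈)))) ,
    All⇒AllPairs disjoint (All.all-filter (T? ∘ class? r) (allTriples n))
      (Unique.filter⁺ (T? ∘ class? r) (Unique.cartesianProduct⁺ (Unique.allFin⁺ n)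
        (Unique.cartesianProduct⁺ (Unique.allFin⁺ n) (Unique.allFin⁺ n))))
    where
    disjoint : ∀ {t u} → T (class? r t) → T (class? r u) → t ≢ u → EdgeDisjoint t u
    disjoint {t} {u} t∈ u∈ with class?⇒ t t∈ | class?⇒ u u∈
    ... | _ , t↗ , t% | _ , u↗ , u% = equal-residue⇒EdgeDisjoint t↗ u↗ (trans t% (sym u%))

  sorted : Fin n → Fin n → Fin n → ℕ
  sorted a b c = ⟦ triangle? (a , b , c) ⟧

  triangles≤6 : triangles G ≤ 6 * sum³ sorted
  triangles≤6 = begin
    triangles G
      ≤⟨ sum³-mono pointwise ⟩
    sum³ (λ a b c → sorted a b c + sorted a c b + sorted b a c + sorted b c a + sorted c a b + sorted c b a)
      ≡⟨ trans (sum³-distrib-+ (λ a b c → sorted a b c + sorted a c b + sorted b a c + sorted b c a + sorted c a b) (λ a b c → sorted c b a))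
           (cong₂ _+_ (trans (sum³-distrib-+ (λ a b c → sorted a b c + sorted a c b + sorted b a c + sorted b c a) (λ a b c → sorted c a b))
             (cong₂ _+_ (trans (sum³-distrib-+ (λ a b c → sorted a b c + sorted a c b + sorted b a c) (λ a b c → sorted b c a))
               (cong₂ _+_ (trans (sum³-distrib-+ (λ a b c → sorted a b c + sorted a c b) (λ a b c → sorted b a c))
                 (cong₂ _+_ (trans (sum³-distrib-+ sorted (λ a b c → sorted a c b)) (cong (sum³ sorted +_) (sum³-swap₂₃ sorted)))
                   (sum³-swap₁₂ sorted))) bca)) cab)) cba) ⟩
    sum³ sorted + sum³ sorted + sum³ sorted + sum³ sorted + sum³ sorted + sum³ sorted
      ≡⟨ eq (sum³ sorted) ⟩
    6 * sum³ sorted ∎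
    where
    pointwise : ∀ a b c → A G a b * A G b c * A G a c ≤ sorted a b c + sorted a c b + sorted b a c + sorted b c a + sorted c a b + sorted c b a
    pointwise a b c rewrite Graph.sym G c b | Graph.sym G b a | Graph.sym G c a
      with adj G a b in ab | adj G b c in bc | adj G a c in ac
    ... | false | _     | _     = z≤n
    ... | true  | false | _     = z≤n
    ... | true  | true  | false = z≤n
    ... | true  | true  | true  = some-order {lt a b} {lt b a} {lt b c} {lt c b} {lt a c} {lt c a} (comparable ab) (comparable bc) (comparable ac)
      where
      comparable : ∀ {x y} → adj G x y ≡ true → T (lt x y ∨ lt y x)
      comparable {x} {y} xy with Fin.<-cmp x y
      ... | tri< x<y _ _    = Equivalence.from T-∨ (inj₁ (<⇒<ᵇ x<y))
      ... | tri≈ _ refl _   = contradiction (trans (sym xy) (irrefl G x)) λ ()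
      ... | tri> _ _ y<x    = Equivalence.from T-∨ (inj₂ (<⇒<ᵇ y<x))
    bca : sum³ (λ a b c → sorted b c a) ≡ sum³ sorted
    bca = trans (sum³-swap₁₂ (λ a b c → sorted a c b)) (sum³-swap₂₃ sorted)
    cab : sum³ (λ a b c → sorted c a b) ≡ sum³ sorted
    cab = trans (sum³-swap₂₃ (λ a b c → sorted b a c)) (sum³-swap₁₂ sorted)
    cba : sum³ (λ a b c → sorted c b a) ≡ sum³ sorted
    cba = trans (sum³-swap₂₃ (λ a b c → sorted b c a)) bca
    eq : ∀ x → x + x + x + x + x + x ≡ 6 * x
    eq = solve-∀

  large-class : ∃[ r ] sum³ sorted ≤ n * length (class r)
  large-class with argmax (λ r → length (class r))
  ... | r , max = r , (begin
    sum³ sorted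
      ≤⟨ sum³-mono pointwise ⟩
    sum³ (λ a b c → sum λ r → ⟦ class? r (a , b , c) ⟧)
      ≡⟨ sum-cong-≗ (λ a → sum-cong-≗ λ b → ∑-comm (λ c r → ⟦ class? r (a , b , c) ⟧)) ⟩
    sum³ (λ a b r → sum λ c → ⟦ class? r (a , b , c) ⟧)
      ≡⟨ sum-cong-≗ (λ a → ∑-comm (λ b r → sum λ c → ⟦ class? r (a , b , c) ⟧)) ⟩
    sum³ (λ a r b → sum λ c → ⟦ class? r (a , b , c) ⟧)
      ≡⟨ ∑-comm (λ a r → sum² λ b c → ⟦ class? r (a , b , c) ⟧) ⟩
    sum (λ r → sum³ λ a b c → ⟦ class? r (a , b , c) ⟧)
      ≡⟨ sum-cong-≗ (λ r → length-select-triples (class? r)) ⟨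
    sum (λ r → length (class r))
      ≤⟨ sum≤n*m max ⟩
    n * length (class r) ∎)
    where
    pointwise : ∀ a b c → sorted a b c ≤ sum λ r → ⟦ class? r (a , b , c) ⟧
    pointwise a b c = begin
      sorted a b c
        ≡⟨ *-identityʳ (sorted a b c) ⟨
      sorted a b c * 1
        ≡⟨ cong (λ x → sorted a b c * ⟦ x ⟧) (Equivalence.to T-≡ (≡⇒≡ᵇ _ _ (sym (Fin.toℕ-fromℕ< (m%n<n (total t) n))))) ⟨
      sorted a b c * ⟦ total t % n ≡ᵇ Fin.toℕ i ⟧
        ≡⟨ ⟦∧⟧ (triangle? t) (total t % n ≡ᵇ Fin.toℕ i) ⟨
      ⟦ class? i t ⟧
        ≤⟨ term≤sum (λ r → ⟦ class? r t ⟧) i ⟩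
      sum (λ r → ⟦ class? r t ⟧) ∎
      where
      t = a , b , c
      i = Fin.fromℕ< (m%n<n (total t) n)

  packing : ∃[ P ] (IsTrianglePacking G P × triangles G ≤ 6 * (n * length P))
  packing = let r , le = large-class in class r , class-packing r , ≤-trans triangles≤6 (*-monoʳ-≤ 6 le)

-- Split graphs of large minimum degree

module _ {n : ℕ} (G : Graph n) (inK : Fin n → Bool) (split : IsSplit G inK) where

  open Split G inK split

  -- The number of neighbours in S: the edges lost at `x` when it is placed on the same side as S.
  w : Fin n → ℕ
  w x = sum λ v → σ v * A G x v

  E≡sum-w : E ≡ sum λ x → κ x * w x
  E≡sum-w = begin-equality
    sum (λ v → σ v * d v)
      ≡⟨ sum-cong-≗ (λ v → *-distribˡ-sum (σ v) (λ x → κ x * A G x v)) ⟩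
    sum² (λ v x → σ v * (κ x * A G x v))
      ≡⟨ ∑-comm (λ v x → σ v * (κ x * A G x v)) ⟩
    sum² (λ x v → σ v * (κ x * A G x v))
      ≡⟨ sum²-cong (λ x v → eq (σ v) (κ x) (A G x v)) ⟩
    sum² (λ x v → κ x * (σ v * A G x v))
      ≡⟨ sum-cong-≗ (λ x → *-distribˡ-sum (κ x) (λ v → σ v * A G x v)) ⟨
    sum (λ x → κ x * w x) ∎
    where
    eq : ∀ x y z → x * (y * z) ≡ y * (x * z)
    eq = solve-∀

  module _ (inA : Fin n → Bool) (A⊆K : ∀ v → T (inA v) → T (inK v)) where

    α β : Fin n → ℕ
    inB : Fin n → Bool
    inB v = inK v ∧ not (inA v)
    α v = ⟦ inA v ⟧
    β v = ⟦ inB v ⟧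

    α+β≡κ : ∀ v → α v + β v ≡ κ v
    α+β≡κ v with inA v in a | inK v in b
    ... | true  | true  = refl
    ... | false | true  = refl
    ... | false | false = refl
    ... | true  | false = contradiction (subst T b (A⊆K v (Equivalence.from T-≡ a))) id

    e : ℕ
    e = sum λ x → α x * w x

    hitting : List (Fin n × Fin n)
    hitting = uncut G inB

    -- The summand `k` on the left is the size of A plus that of its complement in K, the two
    -- diagonals that `clique-pairs` needs to produce full squares.
    hitting-size : 2 * length hitting + k ≤ sum α * sum α + (k ∸ sum α) * (k ∸ sum α) + 2 * e
    hitting-size = begin
      2 * length hitting + k
        ≡⟨ cong (2 * length hitting +_) k≡ ⟩
      2 * length hitting + (a + b)
        ≤⟨ +-monoˡ-≤ (a + b) (≤-trans (2*uncut≤ G inB) (sum²-mono pointwise)) ⟩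
      sum² (λ x y → AA x y + BB x y + AS x y + AS y x) + (a + b)
        ≡⟨ cong (_+ (a + b)) (trans (sum²-distrib-+ (λ x y → AA x y + BB x y + AS x y) (λ x y → AS y x))
             (cong₂ _+_ (trans (sum²-distrib-+ (λ x y → AA x y + BB x y) AS) (cong (_+ sum² AS) (sum²-distrib-+ AA BB)))
                        (∑-comm (λ x y → AS y x)))) ⟩
      sum² AA + sum² BB + sum² AS + sum² AS + (a + b)
        ≡⟨ eq (sum² AA) (sum² BB) (sum² AS) a b ⟩
      (sum² AA + a) + (sum² BB + b) + 2 * sum² AS
        ≡⟨ cong₂ _+_ (cong₂ _+_ (clique-pairs G inA (λ x y x∈ y∈ → proj₁ split x y (A⊆K x x∈) (A⊆K y y∈)))
                                (clique-pairs G inB (λ x y x∈ y∈ → proj₁ split x y (proj₁ (Equivalence.to T-∧ x∈)) (proj₁ (Equivalence.to T-∧ y∈)))))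
                     (cong (2 *_) (sum-cong-≗ λ x → sym (*-distribˡ-sum (α x) (λ y → σ y * A G x y)))) ⟩
      a * a + b * b + 2 * e
        ≡⟨ cong (λ b → a * a + b * b + 2 * e) (trans (sym (m+n∸m≡n a b)) (cong (_∸ a) (sym k≡))) ⟩
      a * a + (k ∸ a) * (k ∸ a) + 2 * e ∎
      where
      a = sum α
      b = sum β
      k≡ : k ≡ a + b
      k≡ = trans (sum-cong-≗ (sym ∘ α+β≡κ)) (∑-distrib-+ α β)
      eq : ∀ x y z a b → x + y + z + z + (a + b) ≡ (x + a) + (y + b) + 2 * z
      eq = solve-∀
      AA BB AS : Fin n → Fin n → ℕ
      AA x y = α x * α y * A G x y
      BB x y = β x * β y * A G x y
      AS x y = α x * (σ y * A G x y)
      pointwise : ∀ x y → A G x y * ⟦ same G inB x y ⟧ ≤ AA x y + BB x y + AS x y + AS y x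
      pointwise x y rewrite Graph.sym G y x with adj G x y in xy
      ... | false = z≤n
      ... | true with inK x in kx | inK y in ky | inA x in ax | inA y in ay
      ...   | true | true | true | true = ≤-refl
      ...   | true | true | true | false = ≤-refl
      ...   | true | true | false | true = ≤-refl
      ...   | true | true | false | false = ≤-refl
      ...   | true | false | true | false = ≤-refl
      ...   | true | false | false | false = ≤-refl
      ...   | false | true | false | true = ≤-refl
      ...   | false | true | false | false = ≤-refl
      ...   | false | false | _ | _ = contradiction (Equivalence.from T-≡ xy) (proj₂ split x y kx ky)
      ...   | false | _ | true | _ = contradiction (subst T kx (A⊆K x (Equivalence.from T-≡ ax))) id
      ...   | _ | false | _ | true = contradiction (subst T ky (A⊆K y (Equivalence.from T-≡ ay))) id

  light-hitting : ∀ a → a ≤ k → ∃[ H ] ∃[ e ] (IsTriangleHitting G H × k * e ≤ a * E ×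
    2 * length H + k ≤ a * a + (k ∸ a) * (k ∸ a) + 2 * e)
  light-hitting a a≤k with light-subset inK w (k ∸ a) a (m+[n∸m]≡n a≤k)
  ... | inA , A⊆K , refl , ke≤ = hitting inA A⊆K , e inA A⊆K , uncut-hits G (inB inA A⊆K) ,
    subst (λ E → k * e inA A⊆K ≤ a * E) (sym E≡sum-w) ke≤ , hitting-size inA A⊆K

  module _ (dense : ∀ v → 3 * n ≤ 5 * degree G v) where

    degree≡d : ∀ v → inK v ≡ false → degree G v ≡ d v
    degree≡d v v∈S = trans (sum-allFin (A G v)) (sum-cong-≗ pointwise)
      where
      pointwise : ∀ x → A G v x ≡ κ x * A G x v
      pointwise x rewrite Graph.sym G v x with inK x in kx
      ... | true  = sym (+-identityʳ _)
      ... | false = ¬Adj⇒A≡0 G (proj₂ split x v kx v∈S)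

    -- Outside S the weight is zero, and on S the degree is `d v`, so the minimum degree condition
    -- may be assumed of the argument.
    σ-weighted : {f g : ℕ → ℕ} → (∀ x → 3 * n ≤ 5 * x → f x ≤ g x) →
      sum (λ v → σ v * f (d v)) ≤ sum (λ v → σ v * g (d v))
    σ-weighted {f} {g} f≤g = sum-mono pointwise
      where
      pointwise : ∀ v → σ v * f (d v) ≤ σ v * g (d v)
      pointwise v with inK v in kv
      ... | true  = z≤n
      ... | false = +-monoˡ-≤ 0 (f≤g (d v) (subst (λ x → 3 * n ≤ 5 * x) (degree≡d v kv) (dense v)))

    σ-affine : ∀ x y → sum (λ v → σ v * (x * d v + y)) ≡ x * E + y * s
    σ-affine = sum-affine σ d

    σ-affine² : ∀ x y → sum (λ v → σ v * (x * (d v * d v) + y)) ≡ x * D + y * s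
    σ-affine² = sum-affine σ (λ v → d v * d v)

    q : ℕ
    q = ceil3/5 n

    sq≤E : s * q ≤ E
    sq≤E = begin
      s * q                  ≡⟨ *-distribʳ-sum q σ ⟩
      sum (λ v → σ v * q)    ≤⟨ σ-weighted {λ _ → q} {id} q≤ ⟩
      E ∎
      where
      q≤ : ∀ x → 3 * n ≤ 5 * x → q ≤ x
      q≤ x le = s≤s⁻¹ (m<n*o⇒m/o<n {n = suc x} (begin-strict
        3 * n + 4    <⟨ +-mono-≤-< le (n<1+n 4) ⟩
        5 * x + 5    ≡⟨ eq x ⟩
        suc x * 5    ∎))
        where
        eq : ∀ x → 5 * x + 5 ≡ suc x * 5
        eq = solve-∀

    E≤sk : E ≤ s * k
    E≤sk = begin
      E                    ≤⟨ sum-mono (λ v → *-monoʳ-≤ (σ v) (d≤k v)) ⟩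
      sum (λ v → σ v * k)  ≡⟨ *-distribʳ-sum k σ ⟨
      s * k                ∎

    -- No integer lies strictly between `q` and `q + 1`, so `(x - q)(x - q - 1) ≥ 0`. This is the
    -- secant of the square through these two points, which beyond `q` lies above the tangent at
    -- `q`.
    tangent : (2 * q + 1) * E ≤ D + s * (q * q + q)
    tangent = begin
      (2 * q + 1) * E
        ≡⟨ +-identityʳ _ ⟨
      (2 * q + 1) * E + 0 * s
        ≡⟨ σ-affine (2 * q + 1) 0 ⟨
      sum (λ v → σ v * ((2 * q + 1) * d v + 0))
        ≤⟨ sum-mono (λ v → *-monoʳ-≤ (σ v) (pointwise (d v))) ⟩
      sum (λ v → σ v * (1 * (d v * d v) + (q * q + q)))
        ≡⟨ σ-affine² 1 (q * q + q) ⟩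
      1 * D + (q * q + q) * s
        ≡⟨ cong₂ _+_ (*-identityˡ D) (*-comm (q * q + q) s) ⟩
      D + s * (q * q + q) ∎
      where
      pointwise : ∀ x → (2 * q + 1) * x + 0 ≤ 1 * (x * x) + (q * q + q)
      pointwise x with x ≤? q
      ... | yes x≤q = subst (λ q → (2 * q + 1) * x + 0 ≤ 1 * (x * x) + (q * q + q)) (m+[n∸m]≡n x≤q)
        (≤-trans (m≤m+n _ (t * t + t)) (≤-reflexive (eq x t)))
        where
        t = q ∸ x
        eq : ∀ x t → (2 * (x + t) + 1) * x + 0 + (t * t + t) ≡ 1 * (x * x) + ((x + t) * (x + t) + (x + t))
        eq = solve-∀
      ... | no x≰q = subst (λ x → (2 * q + 1) * x + 0 ≤ 1 * (x * x) + (q * q + q)) (m+[n∸m]≡n (≰⇒> x≰q))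
        (≤-trans (m≤m+n _ (t * t + t)) (≤-reflexive (eq q t)))
        where
        t = x ∸ suc q
        eq : ∀ q t → (2 * q + 1) * (1 + q + t) + 0 + (t * t + t) ≡ 1 * ((1 + q + t) * (1 + q + t)) + (q * q + q)
        eq = solve-∀

    -- A vertex of S has at most `k` neighbours, so `3n ≤ 5k` once S is nonempty. Summing over S and
    -- cancelling `s` replaces the choice of such a vertex.
    3s≤2k : 3 * s ≤ 2 * k
    3s≤2k with s in s≡ | s*3n≤
      where
      s*3n≤ : s * (3 * n) ≤ s * (5 * k)
      s*3n≤ = begin
        s * (3 * n)                  ≡⟨ *-distribʳ-sum (3 * n) σ ⟩
        sum (λ v → σ v * (3 * n))    ≤⟨ σ-weighted {λ _ → 3 * n} {5 *_} (λ _ → id) ⟩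
        sum (λ v → σ v * (5 * d v))  ≤⟨ sum-mono (λ v → *-monoʳ-≤ (σ v) (*-monoʳ-≤ 5 (d≤k v))) ⟩
        sum (λ v → σ v * (5 * k))    ≡⟨ *-distribʳ-sum (5 * k) σ ⟨
        s * (5 * k) ∎
    ... | zero    | _  = z≤n
    ... | suc s-1 | le = +-cancelˡ-≤ (3 * k) _ _ (begin
      3 * k + 3 * suc s-1   ≡⟨ *-distribˡ-+ 3 k (suc s-1) ⟨
      3 * (k + suc s-1)     ≡⟨ cong (λ s → 3 * (k + s)) s≡ ⟨
      3 * (k + s)           ≡⟨ cong (3 *_) k+s≡n ⟩
      3 * n                 ≤⟨ *-cancelˡ-≤ (suc s-1) le ⟩
      5 * k                 ≡⟨ *-distribʳ-+ k 3 2 ⟩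
      3 * k + 2 * k         ∎)

    module _ (1≤n : 1 ≤ n) where

      -- With `y = 5d` the claim at one vertex is `y(y - 5) ≥ 3n(3n - 5)` for `y ≥ 3n`. If
      -- `y = 3n + t`, the difference is `t(6n + t - 5)`, nonnegative because `n ≥ 1`.
      quadratic : 25 * E + 9 * (n * n) * s ≤ 25 * D + 15 * n * s
      quadratic = begin
        25 * E + 9 * (n * n) * s
          ≡⟨ σ-affine 25 (9 * (n * n)) ⟨
        sum (λ v → σ v * (25 * d v + 9 * (n * n)))
          ≤⟨ σ-weighted {λ x → 25 * x + 9 * (n * n)} {λ x → 25 * (x * x) + 15 * n} pointwise ⟩
        sum (λ v → σ v * (25 * (d v * d v) + 15 * n))
          ≡⟨ σ-affine² 25 (15 * n) ⟩
        25 * D + 15 * n * s ∎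
        where
        lem : ∀ n t → 1 ≤ n → 5 * (3 * n + t) + 9 * (n * n) ≤ (3 * n + t) * (3 * n + t) + 15 * n
        lem n t 1≤n = begin
          5 * (3 * n + t) + 9 * (n * n)         ≡⟨ eq₁ n t ⟩
          5 * t * 1 + (9 * (n * n) + 15 * n)    ≤⟨ +-monoˡ-≤ (9 * (n * n) + 15 * n) (*-monoʳ-≤ (5 * t) 1≤n) ⟩
          5 * t * n + (9 * (n * n) + 15 * n)    ≤⟨ m≤m+n _ (n * t + t * t) ⟩
          5 * t * n + (9 * (n * n) + 15 * n) + (n * t + t * t)  ≡⟨ eq₂ n t ⟩
          (3 * n + t) * (3 * n + t) + 15 * n    ∎
          where
          eq₁ : ∀ n t → 5 * (3 * n + t) + 9 * (n * n) ≡ 5 * t * 1 + (9 * (n * n) + 15 * n)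
          eq₁ = solve-∀
          eq₂ : ∀ n t → 5 * t * n + (9 * (n * n) + 15 * n) + (n * t + t * t) ≡ (3 * n + t) * (3 * n + t) + 15 * n
          eq₂ = solve-∀
        pointwise : ∀ x → 3 * n ≤ 5 * x → 25 * x + 9 * (n * n) ≤ 25 * (x * x) + 15 * n
        pointwise x le = begin
          25 * x + 9 * (n * n)                  ≡⟨ cong (_+ 9 * (n * n)) (*-assoc 5 5 x) ⟩
          5 * (5 * x) + 9 * (n * n)             ≡⟨ cong (λ m → 5 * m + 9 * (n * n)) (m+[n∸m]≡n le) ⟨
          5 * (3 * n + t) + 9 * (n * n)         ≤⟨ lem n t 1≤n ⟩
          (3 * n + t) * (3 * n + t) + 15 * n    ≡⟨ cong (λ m → m * m + 15 * n) (m+[n∸m]≡n le) ⟩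
          (5 * x) * (5 * x) + 15 * n            ≡⟨ eq x n ⟩
          25 * (x * x) + 15 * n                 ∎
          where
          t = 5 * x ∸ 3 * n
          eq : ∀ x n → (5 * x) * (5 * x) + 15 * n ≡ 25 * (x * x) + 15 * n
          eq = solve-∀

      k-positive : 1 ≤ k
      k-positive with k in k≡ | 3s≤2k
      ... | suc _ | _ = s≤s z≤n
      ... | zero  | 3s≤0 = contradiction 1≤n (<⇒≱ (s≤s (≤-reflexive n≡0)))
        where
        n≡0 : n ≡ 0
        n≡0 = trans (sym k+s≡n) (cong₂ _+_ k≡ (n≤0⇒n≡0 (≤-trans (m≤n*m s 3) 3s≤0)))

      large-packing⇒TauLeTwoNu : ∃[ P ] (IsTrianglePacking G P × triangles G ≤ 6 * (n * length P)) → TauLeTwoNu G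
      large-packing⇒TauLeTwoNu (P , P-packs , N≤) =
        let H , e , H-hits , ke≤aE , H≤ = light-hitting ((k ∸ s) / 2) (≤-trans (m/n≤m (k ∸ s) 2) (m∸n≤m k s))
        in H , P , H-hits , P-packs ,
          tuza-inequality {n} {k} {s} {E} {D} {triangles G} {length P} {e} {length H} k+s≡n
            k-positive 3s≤2k
            sq≤E E≤sk
            tangent quadratic
            triangles-lower-bound N≤ ke≤aE H≤

theorem1 : (n : ℕ) (G : Graph n) (inK : Fin n → Bool) →
    IsSplit G inK →
    (∀ v → 3 * n ≤ 5 * degree G v) →
    TauLeTwoNu G
-- The empty graph is separate because residues modulo `n` require `n` to be positive.
theorem1 zero      G inK split dense = [] , [] , ((λ _ _ ()) , λ ()) , ((λ _ ()) , []) , z≤n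
theorem1 n@(suc _) G inK split dense = large-packing⇒TauLeTwoNu G inK split dense (s≤s z≤n) (packing G)
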